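{- Let $R$ be a nonvoid relation on $X\times Y$. Suppose $P_R$ has reduced integral homology in dimension $k\geq0$, that is, $\widetilde H_k(\Delta(P_R);\mathbb{Z})\ne 0$. Then there are at least $(k+2)!$ maximal chains in $P_R$ of length at least $k$.
   Context: Everything is finite. A relation $R$ on $X\times Y$ is a subset of $X\times Y$; it is nonvoid if $X\neq\emptyset$ and $Y\ne\emptyset$. $Y_x=\{y\in Y:(x,y)\in R\}$ and $X_y=\{x\in X:(x,y)\in R\}$. For $\sigma\subseteq X$, $\phi_R(\sigma)=\bigcap_{x\in\sigma}Y_x$ with $\phi_R(\emptyset)=Y$; for $\gamma\subseteq Y$, $\psi_R(\gamma)=\bigcap_{y\in\gamma}X_y$ with $\psi_R(\emptyset)=X$. The doubly-labeled poset $P_R$ consists of all pairs $(\sigma,\gamma)$ with $\emptyset\neq\sigma\subseteq X$, $\emptyset\ne\gamma\subseteq Y$, $\sigma=\psi_R(\gamma)$ and $\gamma=\phi_R(\sigma)$, ordered by $(\sigma_1,\gamma_1)\le(\sigma_2,\gamma_2)$ iff $\sigma_1\subseteq\sigma_2$ (equivalently $\gamma_1\supseteq\gamma_2$). $\Delta(P)$ is the order complex of a poset $P$ (simplices are the chains of $P$). The length of a chain is one less than its number of elements. $\widetilde H_k$ denotes reduced simplicial homology. -}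

module Defs where

open import Algebra.Bundles using (AbelianGroup)
open import Data.Bool.Base using (true; false; if_then_else_)
open import Data.Bool.Properties using () renaming (_≟_ to _≟ᵇ_)
open import Data.Fin.Base using (Fin; zero; suc; toℕ)
open import Data.Fin.Subset using (Subset; _⊆_; ⋂; Nonempty)
open import Data.Fin.Subset.Properties
  using (_∈?_; _⊆?_; ⊆-reflexive; ⊆-trans; ⊆-antisym)
open import Data.Integer.Base using (ℤ; 0ℤ; -1ℤ; _+_; _*_; -_; _^_)
import Data.Integer.Properties as ℤ
open import Data.Integer.Tactic.RingSolver using (solve-∀)
open import Data.List.Base as List using (List; []; _∷_; _++_)
import Data.List.Properties as List
open import Data.Nat.Base using (ℕ; suc; _≤_)
open import Data.Product.Base using (Σ; ∃; _×_; _,_; proj₁)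
open import Data.Vec.Base as Vec using (Vec; []; _∷_)
import Data.Vec.Membership.Setoid as Membership
import Data.Vec.Properties as Vec
import Data.Vec.Relation.Binary.Pointwise.Inductive as Pointwise
open import Data.Vec.Relation.Unary.All using (All; []; _∷_)
open import Data.Vec.Relation.Unary.AllPairs using (AllPairs; []; _∷_)
open import Level using (0ℓ; _⊔_)
open import Relation.Binary.Bundles using (DecPoset)
open import Relation.Binary.Core using (REL; Rel)
open import Relation.Binary.Definitions using (Decidable)
open import Relation.Binary.PropositionalEquality
  using (_≡_; refl; sym; trans; cong; cong₂; module ≡-Reasoning)
open import Relation.Binary.Structures using (IsEquivalence)
import Relation.Binary.Properties.Poset as PosetProperties
open import Relation.Nullary.Decidable using (Dec; does; _×-dec_)

IsTrivial : ∀ {c ℓ} → AbelianGroup c ℓ → Set (c ⊔ ℓ)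
IsTrivial G = ∀ x → x ≈ ε
  where open AbelianGroup G

All-removeAt : ∀ {a p} {A : Set a} {P : A → Set p} {n} {xs : Vec A (suc n)}
               (i : Fin (suc n)) → All P xs → All P (Vec.removeAt xs i)
All-removeAt             zero    (_  ∷ pxs)         = pxs
All-removeAt {n = suc _} (suc i) (px ∷ pxs@(_ ∷ _)) = px ∷ All-removeAt i pxs

AllPairs-removeAt : ∀ {a r} {A : Set a} {R : Rel A r} {n} {xs : Vec A (suc n)}
                    (i : Fin (suc n)) →
                    AllPairs R xs → AllPairs R (Vec.removeAt xs i)
AllPairs-removeAt             zero    (_  ∷ pxs)         = pxs
AllPairs-removeAt {n = suc _} (suc i) (px ∷ pxs@(_ ∷ _)) =
  All-removeAt i px ∷ AllPairs-removeAt i pxs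

module OrderComplex {c ℓ₁ ℓ₂} (P : DecPoset c ℓ₁ ℓ₂) where

  open DecPoset P using (Carrier; _≈_; _≟_; poset; module Eq)
  open PosetProperties poset using (_<_)
  open Membership Eq.setoid using () renaming (_∈_ to _∈ᵛ_)

  -- A chain with n elements, listed in increasing order.  It is a simplex of
  -- the order complex of dimension n - 1 (n = 0 being the empty simplex), and
  -- as a chain of P it has length n - 1.
  record Chain (n : ℕ) : Set (c ⊔ ℓ₁ ⊔ ℓ₂) where
    constructor mkChain
    field
      elements  : Vec Carrier n
      ascending : AllPairs _<_ elements

  open Chain public

  infix 4 _⊑_ _≈ᶜ_ _≟ᶜ_

  _⊑_ : ∀ {m n} → Chain m → Chain n → Set (c ⊔ ℓ₁)
  s ⊑ t = ∀ {x} → x ∈ᵛ elements s → x ∈ᵛ elements t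

  IsMaximal : ∀ {n} → Chain n → Set (c ⊔ ℓ₁ ⊔ ℓ₂)
  IsMaximal s = ∀ {m} (t : Chain m) → s ⊑ t → t ⊑ s

  record MaximalChain : Set (c ⊔ ℓ₁ ⊔ ℓ₂) where
    field
      size    : ℕ
      chain   : Chain size
      maximal : IsMaximal chain

  open MaximalChain public

  -- Equality of maximal chains as sets of elements of P.
  _≋_ : Rel MaximalChain (c ⊔ ℓ₁)
  s ≋ t = (chain s ⊑ chain t) × (chain t ⊑ chain s)

  -- The length of a chain is size - 1.
  HasLength≥ : ℕ → MaximalChain → Set
  HasLength≥ k s = suc k ≤ size s

  _≈ᶜ_ : ∀ {n} → Rel (Chain n) (c ⊔ ℓ₁)
  s ≈ᶜ t = Pointwise.Pointwise _≈_ (elements s) (elements t)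

  _≟ᶜ_ : ∀ {n} (s t : Chain n) → Dec (s ≈ᶜ t)
  s ≟ᶜ t = Pointwise.decidable _≟_ (elements s) (elements t)

  face : ∀ {n} → Fin (suc n) → Chain (suc n) → Chain n
  face i (mkChain xs asc) =
    mkChain (Vec.removeAt xs i) (AllPairs-removeAt i asc)

  -- Formal ℤ-linear combinations of (n - 1)-simplices.  Two of them are
  -- identified (_∼_) when all their coefficients agree, so that
  -- (FormalSum n , _∼_) is the free abelian group on the (n - 1)-simplices.
  FormalSum : ℕ → Set (c ⊔ ℓ₁ ⊔ ℓ₂)
  FormalSum n = List (ℤ × Chain n)

  coeff : ∀ {n} → FormalSum n → Chain n → ℤ
  coeff []            s = 0ℤ
  coeff ((a , t) ∷ z) s = (if does (t ≟ᶜ s) then a else 0ℤ) + coeff z s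

  infix 4 _∼_

  _∼_ : ∀ {n} → Rel (FormalSum n) (c ⊔ ℓ₁ ⊔ ℓ₂)
  z ∼ w = ∀ s → coeff z s ≡ coeff w s

  negate : ∀ {n} → FormalSum n → FormalSum n
  negate = List.map λ (a , s) → (- a , s)

  -- On FormalSum 1 this is the augmentation, the empty simplex being a basis
  -- of FormalSum 0; hence the homology below is reduced.
  ∂ : ∀ {n} → FormalSum (suc n) → FormalSum n
  ∂ = List.concatMap λ (a , s) →
        List.tabulate λ i → (a * -1ℤ ^ toℕ i , face i s)

  coeff-++ : ∀ {n} (z w : FormalSum n) s → coeff (z ++ w) s ≡ coeff z s + coeff w s
  coeff-++ []            w s = sym (ℤ.+-identityˡ _)
  coeff-++ ((a , t) ∷ z) w s =
    trans (cong (b +_) (coeff-++ z w s)) (sym (ℤ.+-assoc b (coeff z s) (coeff w s)))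
    where b = if does (t ≟ᶜ s) then a else 0ℤ

  coeff-negate : ∀ {n} (z : FormalSum n) s → coeff (negate z) s ≡ - coeff z s
  coeff-negate []            s = refl
  coeff-negate ((a , t) ∷ z) s with does (t ≟ᶜ s)
  ... | true  =
    trans (cong (- a +_) (coeff-negate z s)) (sym (ℤ.neg-distrib-+ a (coeff z s)))
  ... | false =
    trans (cong (0ℤ +_) (coeff-negate z s)) (sym (ℤ.neg-distrib-+ 0ℤ (coeff z s)))

  ∂-++ : ∀ {n} (z w : FormalSum (suc n)) → ∂ (z ++ w) ≡ ∂ z ++ ∂ w
  ∂-++ z w = List.concatMap-++ _ z w

  ∂-negate : ∀ {n} (z : FormalSum (suc n)) → ∂ (negate z) ≡ negate (∂ z)
  ∂-negate []            = refl
  ∂-negate ((a , s) ∷ z) = begin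
    List.tabulate (λ i → (- a * -1ℤ ^ toℕ i , face i s)) ++ ∂ (negate z)
      ≡⟨ cong₂ _++_ (List.tabulate-cong λ i →
           cong (_, face i s) (sym (ℤ.neg-distribˡ-* a (-1ℤ ^ toℕ i)))) (∂-negate z) ⟩
    List.tabulate (λ i → (- (a * -1ℤ ^ toℕ i) , face i s)) ++ negate (∂ z)
      ≡⟨ cong (_++ negate (∂ z)) (List.map-tabulate (λ i → (a * -1ℤ ^ toℕ i , face i s)) _) ⟨
    negate (List.tabulate (λ i → (a * -1ℤ ^ toℕ i , face i s))) ++ negate (∂ z)
      ≡⟨ List.map-++ _ (List.tabulate λ i → (a * -1ℤ ^ toℕ i , face i s)) (∂ z) ⟨
    negate (∂ ((a , s) ∷ z)) ∎
    where open ≡-Reasoning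

  Cycle : ℕ → Set (c ⊔ ℓ₁ ⊔ ℓ₂)
  Cycle k = Σ (FormalSum (suc k)) λ z → ∂ z ∼ []

  Homologous : ∀ {k} → Rel (Cycle k) (c ⊔ ℓ₁ ⊔ ℓ₂)
  Homologous {k} (z , _) (w , _) = ∃ λ (b : FormalSum (suc (suc k))) → z ∼ w ++ ∂ b

  private
    coeff-∂-++ : ∀ {n} (z w : FormalSum (suc n)) s →
                 coeff (∂ (z ++ w)) s ≡ coeff (∂ z) s + coeff (∂ w) s
    coeff-∂-++ z w s = trans (cong (λ v → coeff v s) (∂-++ z w)) (coeff-++ (∂ z) (∂ w) s)

    coeff-∂-negate : ∀ {n} (z : FormalSum (suc n)) s →
                     coeff (∂ (negate z)) s ≡ - coeff (∂ z) s
    coeff-∂-negate z s =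
      trans (cong (λ v → coeff v s) (∂-negate z)) (coeff-negate (∂ z) s)

    +-inverse-swap : ∀ {x y d} → x ≡ y + d → y ≡ x + - d
    +-inverse-swap {y = y} {d} refl = lemma y d
      where
      lemma : ∀ y d → y ≡ (y + d) + - d
      lemma = solve-∀

    medial : ∀ a b c d → (a + b) + (c + d) ≡ (a + c) + (b + d)
    medial = solve-∀

  _+ᶻ_ : ∀ {k} → Cycle k → Cycle k → Cycle k
  (z , p) +ᶻ (w , q) = z ++ w , λ s → trans (coeff-∂-++ z w s) (cong₂ _+_ (p s) (q s))

  0ᶻ : ∀ {k} → Cycle k
  0ᶻ = [] , λ _ → refl

  -ᶻ_ : ∀ {k} → Cycle k → Cycle k
  -ᶻ (z , p) = negate z , λ s → trans (coeff-∂-negate z s) (cong -_ (p s))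

  private
    ∼⇒Homologous : ∀ {k} (z w : Cycle k) → proj₁ z ∼ proj₁ w → Homologous z w
    ∼⇒Homologous (z , _) (w , _) eq = [] , λ s →
      trans (eq s) (sym (trans (coeff-++ w [] s) (ℤ.+-identityʳ _)))

    homologous-refl : ∀ {k} (z : Cycle k) → Homologous z z
    homologous-refl z = ∼⇒Homologous z z λ _ → refl

    homologous-sym : ∀ {k} (z w : Cycle k) → Homologous z w → Homologous w z
    homologous-sym (z , _) (w , _) (b , eq) = negate b , λ s → begin
      coeff w s                               ≡⟨ +-inverse-swap (trans (eq s) (coeff-++ w (∂ b) s)) ⟩
      coeff z s + - coeff (∂ b) s             ≡⟨ cong (coeff z s +_) (coeff-∂-negate b s) ⟨
      coeff z s + coeff (∂ (negate b)) s      ≡⟨ coeff-++ z (∂ (negate b)) s ⟨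
      coeff (z ++ ∂ (negate b)) s             ∎
      where open ≡-Reasoning

    homologous-trans : ∀ {k} (z w v : Cycle k) →
                       Homologous z w → Homologous w v → Homologous z v
    homologous-trans (z , _) (w , _) (v , _) (b , eq) (b′ , eq′) = b′ ++ b , λ s → begin
      coeff z s                                             ≡⟨ eq s ⟩
      coeff (w ++ ∂ b) s                                    ≡⟨ coeff-++ w (∂ b) s ⟩
      coeff w s + coeff (∂ b) s                             ≡⟨ cong (_+ coeff (∂ b) s) (trans (eq′ s) (coeff-++ v (∂ b′) s)) ⟩
      (coeff v s + coeff (∂ b′) s) + coeff (∂ b) s          ≡⟨ ℤ.+-assoc (coeff v s) _ _ ⟩
      coeff v s + (coeff (∂ b′) s + coeff (∂ b) s)          ≡⟨ cong (coeff v s +_) (coeff-∂-++ b′ b s) ⟨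
      coeff v s + coeff (∂ (b′ ++ b)) s                     ≡⟨ coeff-++ v (∂ (b′ ++ b)) s ⟨
      coeff (v ++ ∂ (b′ ++ b)) s                            ∎
      where open ≡-Reasoning

    +ᶻ-cong : ∀ {k} (z z′ w w′ : Cycle k) →
              Homologous z z′ → Homologous w w′ → Homologous (z +ᶻ w) (z′ +ᶻ w′)
    +ᶻ-cong (z , _) (z′ , _) (w , _) (w′ , _) (b , eq) (d , eq′) = b ++ d , λ s → begin
      coeff (z ++ w) s                                                ≡⟨ coeff-++ z w s ⟩
      coeff z s + coeff w s                                           ≡⟨ cong₂ _+_ (trans (eq s) (coeff-++ z′ (∂ b) s)) (trans (eq′ s) (coeff-++ w′ (∂ d) s)) ⟩
      (coeff z′ s + coeff (∂ b) s) + (coeff w′ s + coeff (∂ d) s)     ≡⟨ medial (coeff z′ s) _ _ _ ⟩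
      (coeff z′ s + coeff w′ s) + (coeff (∂ b) s + coeff (∂ d) s)     ≡⟨ cong₂ _+_ (coeff-++ z′ w′ s) (coeff-∂-++ b d s) ⟨
      coeff (z′ ++ w′) s + coeff (∂ (b ++ d)) s                       ≡⟨ coeff-++ (z′ ++ w′) (∂ (b ++ d)) s ⟨
      coeff ((z′ ++ w′) ++ ∂ (b ++ d)) s                              ∎
      where open ≡-Reasoning

    -ᶻ-cong : ∀ {k} (z w : Cycle k) → Homologous z w → Homologous (-ᶻ z) (-ᶻ w)
    -ᶻ-cong (z , _) (w , _) (b , eq) = negate b , λ s → begin
      coeff (negate z) s                               ≡⟨ coeff-negate z s ⟩
      - coeff z s                                      ≡⟨ cong -_ (trans (eq s) (coeff-++ w (∂ b) s)) ⟩
      - (coeff w s + coeff (∂ b) s)                    ≡⟨ ℤ.neg-distrib-+ (coeff w s) _ ⟩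
      - coeff w s + - coeff (∂ b) s                    ≡⟨ cong₂ _+_ (coeff-negate w s) (coeff-∂-negate b s) ⟨
      coeff (negate w) s + coeff (∂ (negate b)) s      ≡⟨ coeff-++ (negate w) (∂ (negate b)) s ⟨
      coeff (negate w ++ ∂ (negate b)) s               ∎
      where open ≡-Reasoning

    +ᶻ-comm : ∀ {k} (z w : Cycle k) → Homologous (z +ᶻ w) (w +ᶻ z)
    +ᶻ-comm z@(u , _) w@(v , _) = ∼⇒Homologous (z +ᶻ w) (w +ᶻ z) λ s →
      trans (coeff-++ u v s) (trans (ℤ.+-comm (coeff u s) _) (sym (coeff-++ v u s)))

    +ᶻ-inverseˡ : ∀ {k} (z : Cycle k) → Homologous ((-ᶻ z) +ᶻ z) 0ᶻ
    +ᶻ-inverseˡ z@(u , _) = ∼⇒Homologous ((-ᶻ z) +ᶻ z) 0ᶻ λ s →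
      trans (coeff-++ (negate u) u s)
        (trans (cong (_+ coeff u s) (coeff-negate u s)) (ℤ.+-inverseˡ (coeff u s)))

    +ᶻ-identityˡ : ∀ {k} (z : Cycle k) → Homologous (0ᶻ +ᶻ z) z
    +ᶻ-identityˡ z = ∼⇒Homologous (0ᶻ +ᶻ z) z λ _ → refl

    +ᶻ-identityʳ : ∀ {k} (z : Cycle k) → Homologous (z +ᶻ 0ᶻ) z
    +ᶻ-identityʳ z =
      homologous-trans (z +ᶻ 0ᶻ) (0ᶻ +ᶻ z) z (+ᶻ-comm z 0ᶻ) (+ᶻ-identityˡ z)

    +ᶻ-inverseʳ : ∀ {k} (z : Cycle k) → Homologous (z +ᶻ (-ᶻ z)) 0ᶻ
    +ᶻ-inverseʳ z =
      homologous-trans (z +ᶻ (-ᶻ z)) ((-ᶻ z) +ᶻ z) 0ᶻ (+ᶻ-comm z (-ᶻ z)) (+ᶻ-inverseˡ z)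

    +ᶻ-assoc : ∀ {k} (x y z : Cycle k) → Homologous ((x +ᶻ y) +ᶻ z) (x +ᶻ (y +ᶻ z))
    +ᶻ-assoc x y z = ∼⇒Homologous ((x +ᶻ y) +ᶻ z) (x +ᶻ (y +ᶻ z)) λ s →
      cong (λ u → coeff u s) (List.++-assoc (proj₁ x) (proj₁ y) (proj₁ z))

  H̃ : ℕ → AbelianGroup (c ⊔ ℓ₁ ⊔ ℓ₂) (c ⊔ ℓ₁ ⊔ ℓ₂)
  H̃ k = record
    { Carrier        = Cycle k
    ; _≈_            = Homologous
    ; _∙_            = _+ᶻ_
    ; ε              = 0ᶻ
    ; _⁻¹            = -ᶻ_
    ; isAbelianGroup = record
      { isGroup = record
        { isMonoid = record
          { isSemigroup = record
            { isMagma = record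
              { isEquivalence = isEquivalence
              ; ∙-cong        = λ {x} {y} {u} {v} → +ᶻ-cong x y u v
              }
            ; assoc = +ᶻ-assoc
            }
          ; identity = +ᶻ-identityˡ , +ᶻ-identityʳ
          }
        ; inverse = +ᶻ-inverseˡ , +ᶻ-inverseʳ
        ; ⁻¹-cong = λ {x} {y} → -ᶻ-cong x y
        }
      ; comm = +ᶻ-comm
      }
    }
    where
    isEquivalence : IsEquivalence (Homologous {k})
    isEquivalence = record
      { refl  = λ {x} → homologous-refl x
      ; sym   = λ {x} {y} → homologous-sym x y
      ; trans = λ {x} {y} {z} → homologous-trans x y z
      }

module Relation {ℓ} {m n : ℕ} (R : REL (Fin m) (Fin n) ℓ) (R? : Decidable R) where

  row : Fin m → Subset n
  row x = Vec.tabulate λ y → does (R? x y)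

  column : Fin n → Subset m
  column y = Vec.tabulate λ x → does (R? x y)

  members : ∀ {k} → Subset k → List (Fin k)
  members p = List.filter (_∈? p) (List.allFin _)

  φ : Subset m → Subset n
  φ σ = ⋂ (List.map row (members σ))

  ψ : Subset n → Subset m
  ψ γ = ⋂ (List.map column (members γ))

  record Element : Set where
    field
      σ          : Subset m
      γ          : Subset n
      σ-nonempty : Nonempty σ
      γ-nonempty : Nonempty γ
      σ≡ψγ       : σ ≡ ψ γ
      γ≡φσ       : γ ≡ φ σ

  open Element public

  _≈ₚ_ : Rel Element 0ℓ
  p ≈ₚ q = σ p ≡ σ q × γ p ≡ γ q

  _≤ₚ_ : Rel Element 0ℓ
  p ≤ₚ q = σ p ⊆ σ q

  P : DecPoset 0ℓ 0ℓ 0ℓ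
  P = record
    { Carrier           = Element
    ; _≈_               = _≈ₚ_
    ; _≤_               = _≤ₚ_
    ; isDecPartialOrder = record
      { isPartialOrder = record
        { isPreorder = record
          { isEquivalence = record
            { refl  = refl , refl
            ; sym   = λ (e , e′) → sym e , sym e′
            ; trans = λ (e , e′) (f , f′) → trans e f , trans e′ f′
            }
          ; reflexive = λ (e , _) → ⊆-reflexive e
          ; trans     = λ {p} {q} {r} → ⊆-trans {i = σ p} {σ q} {σ r}
          }
        ; antisym = λ {p} {q} p≤q q≤p → antisym p q (⊆-antisym p≤q q≤p)
        }
      ; _≟_  = λ p q → Vec.≡-dec _≟ᵇ_ (σ p) (σ q) ×-dec Vec.≡-dec _≟ᵇ_ (γ p) (γ q)
      ; _≤?_ = λ p q → σ p ⊆? σ q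
      }
    }
    where
    antisym : ∀ p q → σ p ≡ σ q → p ≈ₚ q
    antisym p q e = e , trans (γ≡φσ p) (trans (cong φ e) (sym (γ≡φσ q)))

{-# OPTIONS --safe #-}
-- Call a minimal element a of a poset Q good if H̃ₖ₋₁(Q_{>a}) = 0 and bad otherwise.  Deleting a
-- good element preserves the nonvanishing of H̃ₖ, by Mayer–Vietoris for the cone Q_{≥a} and
-- Q ∖ a, and maximal chains of Q ∖ a extend to maximal chains of Q.  So assume that all minimal
-- elements are bad.  There are at least k + 2 of them: as bounded pairs have joins, two principal
-- upsets meet in a principal upset or not at all, and induction with Mayer–Vietoris shows that a
-- union of at most k + 1 principal upsets has no homology in dimension k ≥ 0.  By induction on k
-- each of them starts (k + 1)! maximal chains of length at least k, and (k + 2)(k + 1)! = (k + 2)!.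
-- Constructively the argument produces, for every Q, either the chains or the bounding chains.
module Submission where

open import Defs
open import Data.Bool.Base using (if_then_else_)
import Data.Bool.Properties as Bool
open import Data.Fin.Base using (Fin; zero; suc; toℕ; inject≤; remQuot; combine)
import Data.Fin.Properties as Fin
open import Data.Fin.Subset using (Subset; Nonempty; ⋂; _∩_; _⊆_; inside; outside)
  renaming (_∈_ to _∈ˢ_)
open import Data.Fin.Subset.Properties
  using (_∈?_; nonempty?; ∈⊤; x∈p∩q⁺; x∈p∩q⁻; ⊆-antisym; drop-∷-⊆)
import Data.Integer.Properties as ℤ
open import Data.Integer.Tactic.RingSolver using (solve-∀)
open import Data.List.Base as List
  using (List; []; _∷_; _++_; [_]; foldr; map; filter; tabulate; length; lookup)
open import Data.List.Membership.Propositional using () renaming (_∈_ to _∈ᴸ_)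
import Data.List.Membership.Propositional.Properties as ∈ᴸ
import Data.List.Membership.Setoid as ListMembership
open import Data.List.Membership.Setoid.Properties using (∈-filter⁺)
import Data.List.Properties as List
open import Data.List.Relation.Unary.All as All using (All; []; _∷_)
import Data.List.Relation.Unary.All.Properties as All
open import Data.List.Relation.Unary.AllPairs as ListAllPairs using ([]; _∷_)
  renaming (AllPairs to ListAllPairs)
import Data.List.Relation.Unary.AllPairs.Properties as ListAllPairs
open import Data.List.Relation.Unary.Any as Any using (Any; here; there; any?)
import Data.List.Relation.Unary.Any.Properties as Any
open import Data.Nat.Base as ℕ using (ℕ; zero; suc; s≤s; z≤n; NonZero; _!)
import Data.Nat.Properties as ℕ
open import Data.Product.Base using (Σ; ∃; _×_; _,_; proj₁; proj₂; uncurry)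
open import Data.Sum.Base using (_⊎_; inj₁; inj₂; [_,_]′) renaming (map to ⊎-map)
open import Data.Unit.Polymorphic.Base using (⊤; tt)
open import Data.Vec.Base as Vec using (Vec; []; _∷_; removeAt)
import Data.Vec.Membership.Setoid as VecMembership
import Data.Vec.Properties as Vec
open import Data.Vec.Relation.Binary.Pointwise.Inductive as Pw using (Pointwise; []; _∷_)
open import Data.Vec.Relation.Unary.All as Allᵛ using ([]; _∷_) renaming (All to Allᵛ)
open import Data.Vec.Relation.Unary.AllPairs using (AllPairs; []; _∷_)
open import Data.Vec.Relation.Unary.Any using (here; there)
open import Function.Base using (_∘_; id)
open import Function.Definitions using (Injective)
open import Level using (Level; _⊔_; 0ℓ)
open import Relation.Binary.Bundles using (DecPoset)
open import Relation.Binary.Core using (REL)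
open import Relation.Binary.Definitions using (Decidable)
import Relation.Binary.Properties.Poset as PosetProperties
open import Relation.Binary.PropositionalEquality
  using (_≡_; refl; sym; trans; cong; cong₂; subst; module ≡-Reasoning)
open import Relation.Nullary.Decidable
  using (Dec; yes; no; does; ¬?; _×-dec_; dec-true; map′)
open import Relation.Nullary.Negation using (¬_; contradiction)
open import Relation.Unary using (Pred)

-- Cochains on tuples and their pairing with simplicial chains.

module Homology {c ℓ₁ ℓ₂ : Level} (P : DecPoset c ℓ₁ ℓ₂) where

  open import Data.Integer.Base using (ℤ; 0ℤ; 1ℤ; -1ℤ; -_; _+_; _*_; _^_)
  open DecPoset P using (_≈_; _≤_; _≟_; _≤?_; module Eq)
    renaming (Carrier to C; trans to ≤-trans; refl to ≤-refl; reflexive to ≤-reflexive)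
  open PosetProperties (DecPoset.poset P) using (_<_; <-trans)
  open OrderComplex P

  infix 4 _≋ᵛ_

  _≋ᵛ_ : ∀ {n} → Vec C n → Vec C n → Set (c ⊔ ℓ₁)
  _≋ᵛ_ = Pointwise _≈_

  _≟ᵛ_ : ∀ {n} (s t : Vec C n) → Dec (s ≋ᵛ t)
  _≟ᵛ_ = Pw.decidable _≟_

  Cochain : ℕ → Set c
  Cochain n = Vec C n → ℤ

  Respectful : ∀ {n} → Cochain n → Set (c ⊔ ℓ₁)
  Respectful g = ∀ {s t} → s ≋ᵛ t → g s ≡ g t

  -- The simplicial coboundary, an alternating sum over deletions of one entry, unfolded along the
  -- first entry. It is defined on all tuples, ascending or not, so its identities carry no order
  -- conditions.
  δ : ∀ {n} → Cochain n → Cochain (suc n)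
  δ {zero}  g (x ∷ s) = g s
  δ {suc n} g (x ∷ s) = g s + - δ (g ∘ (x ∷_)) s

  δ-cong : ∀ {p} {Q : Pred C p} {n} {f g : Cochain n} →
           (∀ {s} → Allᵛ Q s → f s ≡ g s) → ∀ {s} → Allᵛ Q s → δ f s ≡ δ g s
  δ-cong {n = zero}  f≡g (_ ∷ qs) = f≡g qs
  δ-cong {n = suc n} f≡g (q ∷ qs) =
    cong₂ (λ a b → a + - b) (f≡g qs) (δ-cong (λ qs → f≡g (q ∷ qs)) qs)

  All-true : ∀ {n} (s : Vec C n) → Allᵛ (λ _ → ⊤ {0ℓ}) s
  All-true s = Allᵛ.universal (λ _ → tt) s

  δ-pointwise : ∀ {n} {f g : Cochain n} → (∀ s → f s ≡ g s) → ∀ s → δ f s ≡ δ g s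
  δ-pointwise f≡g s = δ-cong (λ {t} _ → f≡g t) (All-true s)

  δ-zero : ∀ {n} (s : Vec C (suc n)) → δ (λ _ → 0ℤ) s ≡ 0ℤ
  δ-zero {zero}  (x ∷ s) = refl
  δ-zero {suc n} (x ∷ s) = cong (λ a → 0ℤ + - a) (δ-zero s)

  δ-minus : ∀ {n} (f g : Cochain n) s → δ (λ t → f t + - g t) s ≡ δ f s + - δ g s
  δ-minus {zero}  f g (x ∷ s) = refl
  δ-minus {suc n} f g (x ∷ s) =
    trans (cong (λ a → f s + - g s + - a) (δ-minus (f ∘ (x ∷_)) (g ∘ (x ∷_)) s))
          (lemma (f s) (g s) (δ (f ∘ (x ∷_)) s) (δ (g ∘ (x ∷_)) s))
    where
    lemma : ∀ a b c d → a + - b + - (c + - d) ≡ a + - c + - (b + - d)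
    lemma = solve-∀

  δ∘δ : ∀ {n} (g : Cochain n) s → δ (δ g) s ≡ 0ℤ
  δ∘δ {zero}  g (x ∷ y ∷ []) = ℤ.+-inverseʳ (g [])
  δ∘δ {suc n} g (x ∷ y ∷ s)  = begin
    δ g (y ∷ s) + - δ (λ t → g t + - δ gₓ t) (y ∷ s)
      ≡⟨ cong (λ a → δ g (y ∷ s) + - a) (δ-minus g (δ gₓ) (y ∷ s)) ⟩
    δ g (y ∷ s) + - (δ g (y ∷ s) + - δ (δ gₓ) (y ∷ s))
      ≡⟨ cong (λ a → δ g (y ∷ s) + - (δ g (y ∷ s) + - a)) (δ∘δ gₓ (y ∷ s)) ⟩
    δ g (y ∷ s) + - (δ g (y ∷ s) + 0ℤ)
      ≡⟨ cong (λ a → δ g (y ∷ s) + - a) (ℤ.+-identityʳ (δ g (y ∷ s))) ⟩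
    δ g (y ∷ s) + - δ g (y ∷ s)
      ≡⟨ ℤ.+-inverseʳ (δ g (y ∷ s)) ⟩
    0ℤ ∎
    where
    open ≡-Reasoning
    gₓ = g ∘ (x ∷_)

  δ-resp : ∀ {n} {g : Cochain n} → Respectful g → Respectful (δ g)
  δ-resp {zero}  g-resp (_ ∷ e) = g-resp e
  δ-resp {suc n} {g} g-resp {x ∷ s} {y ∷ t} (x≈y ∷ e) =
    cong₂ (λ a b → a + - b) (g-resp e)
      (trans (δ-resp (λ e′ → g-resp (Eq.refl ∷ e′)) e)
             (δ-pointwise (λ u → g-resp (x≈y ∷ Pw.refl Eq.refl)) t))

  -- Matches the recursive `δ` with the signs in `∂`. The scalar `a` is general so that the
  -- induction step can absorb the sign -1 of the tail.
  δ-removeAt : ∀ {n} (g : Cochain n) a (s : Vec C (suc n)) →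
               foldr _+_ 0ℤ (tabulate λ i → a * -1ℤ ^ toℕ i * g (removeAt s i)) ≡ a * δ g s
  δ-removeAt {zero}  g a (x ∷ []) = trans (ℤ.+-identityʳ _) (cong (_* g []) (ℤ.*-identityʳ a))
  δ-removeAt {suc n} g a (x ∷ s@(_ ∷ _)) = begin
    a * 1ℤ * g s + foldr _+_ 0ℤ (tabulate λ i → a * (-1ℤ * -1ℤ ^ toℕ i) * gₓ (removeAt s i))
      ≡⟨ cong₂ (λ b l → b * g s + foldr _+_ 0ℤ l) (ℤ.*-identityʳ a)
           (List.tabulate-cong λ i →
             cong (_* gₓ (removeAt s i)) (sym (ℤ.*-assoc a -1ℤ (-1ℤ ^ toℕ i)))) ⟩
    a * g s + foldr _+_ 0ℤ (tabulate λ i → a * -1ℤ * -1ℤ ^ toℕ i * gₓ (removeAt s i))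
      ≡⟨ cong (a * g s +_) (δ-removeAt gₓ (a * -1ℤ) s) ⟩
    a * g s + a * -1ℤ * δ gₓ s
      ≡⟨ lemma a (g s) (δ gₓ s) ⟩
    a * (g s + - δ gₓ s) ∎
    where
    open ≡-Reasoning
    gₓ = g ∘ (x ∷_)
    lemma : ∀ a b c → a * b + a * -1ℤ * c ≡ a * (b + - c)
    lemma = solve-∀

  -- Equality of formal sums is tested against all respectful cochains, so that chain-level
  -- identities become pointwise identities between cochains.
  eval : ∀ {n} → FormalSum n → Cochain n → ℤ
  eval []            g = 0ℤ
  eval ((a , s) ∷ z) g = a * g (elements s) + eval z g

  eval-++ : ∀ {n} (z w : FormalSum n) g → eval (z ++ w) g ≡ eval z g + eval w g
  eval-++ []            w g = sym (ℤ.+-identityˡ _)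
  eval-++ ((a , s) ∷ z) w g =
    trans (cong (a * g (elements s) +_) (eval-++ z w g))
          (sym (ℤ.+-assoc (a * g (elements s)) (eval z g) (eval w g)))

  eval-negate : ∀ {n} (z : FormalSum n) g → eval (negate z) g ≡ - eval z g
  eval-negate []            g = refl
  eval-negate ((a , s) ∷ z) g =
    trans (cong₂ _+_ (sym (ℤ.neg-distribˡ-* a (g (elements s)))) (eval-negate z g))
          (sym (ℤ.neg-distrib-+ (a * g (elements s)) (eval z g)))

  eval-minus : ∀ {n} (z w : FormalSum n) g → eval (z ++ negate w) g ≡ eval z g + - eval w g
  eval-minus z w g = trans (eval-++ z (negate w) g) (cong (eval z g +_) (eval-negate w g))

  eval-tabulate : ∀ {m n} (w : Fin m → ℤ × Chain n) g →
                  eval (tabulate w) g ≡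
                  foldr _+_ 0ℤ (tabulate λ i → proj₁ (w i) * g (elements (proj₂ (w i))))
  eval-tabulate {zero}  w g = refl
  eval-tabulate {suc m} w g =
    cong (proj₁ (w zero) * g (elements (proj₂ (w zero))) +_) (eval-tabulate (w ∘ suc) g)

  eval-∂ : ∀ {n} (z : FormalSum (suc n)) g → eval (∂ z) g ≡ eval z (δ g)
  eval-∂ []            g = refl
  eval-∂ ((a , s) ∷ z) g =
    trans (eval-++ (tabulate λ i → (a * -1ℤ ^ toℕ i , face i s)) (∂ z) g)
      (cong₂ _+_
        (trans (eval-tabulate (λ i → (a * -1ℤ ^ toℕ i , face i s)) g) (δ-removeAt g a (elements s)))
        (eval-∂ z g))

  -- A condition on every listed term, even on terms that cancel.
  Supported : ∀ {n p} → (Vec C n → Set p) → FormalSum n → Set (c ⊔ ℓ₁ ⊔ ℓ₂ ⊔ p)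
  Supported Q = All (λ (_ , s) → Q (elements s))

  eval-cong-on : ∀ {n p} {Q : Vec C n → Set p} {f g : Cochain n} {z} → Supported Q z →
                 (∀ (s : Chain n) → Q (elements s) → f (elements s) ≡ g (elements s)) →
                 eval z f ≡ eval z g
  eval-cong-on []       f≡g = refl
  eval-cong-on {z = (a , s) ∷ _} (q ∷ qs) f≡g =
    cong₂ _+_ (cong (a *_) (f≡g s q)) (eval-cong-on qs f≡g)

  eval-cong : ∀ {n} (z : FormalSum n) {f g : Cochain n} → (∀ s → f s ≡ g s) → eval z f ≡ eval z g
  eval-cong z f≡g = eval-cong-on (All.universal (λ _ → tt {0ℓ}) z) (λ s _ → f≡g (elements s))

  eval-zero : ∀ {n} (z : FormalSum n) → eval z (λ _ → 0ℤ) ≡ 0ℤ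
  eval-zero []            = refl
  eval-zero ((a , s) ∷ z) = cong₂ _+_ (ℤ.*-zeroʳ a) (eval-zero z)

  eval-+ : ∀ {n} (z : FormalSum n) f g → eval z (λ s → f s + g s) ≡ eval z f + eval z g
  eval-+ []            f g = refl
  eval-+ ((a , s) ∷ z) f g =
    trans (cong (a * (f (elements s) + g (elements s)) +_) (eval-+ z f g))
          (lemma a (f (elements s)) (g (elements s)) (eval z f) (eval z g))
    where
    lemma : ∀ a b c d e → a * (b + c) + (d + e) ≡ a * b + d + (a * c + e)
    lemma = solve-∀

  eval-* : ∀ {n} (z : FormalSum n) b f → eval z (λ s → b * f s) ≡ b * eval z f
  eval-* []            b f = sym (ℤ.*-zeroʳ b)
  eval-* ((a , s) ∷ z) b f =
    trans (cong (a * (b * f (elements s)) +_) (eval-* z b f))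
          (lemma a b (f (elements s)) (eval z f))
    where
    lemma : ∀ a b c d → a * (b * c) + b * d ≡ b * (a * c + d)
    lemma = solve-∀

  0-term : ∀ a b → a * 0ℤ + b ≡ b
  0-term a b = trans (cong (_+ b) (ℤ.*-zeroʳ a)) (ℤ.+-identityˡ b)

  indicator : ∀ {n} → Vec C n → Cochain n
  indicator s t = if does (t ≟ᵛ s) then 1ℤ else 0ℤ

  indicator-resp : ∀ {n} (s : Vec C n) → Respectful (indicator s)
  indicator-resp s {t} {u} t≈u with t ≟ᵛ s | u ≟ᵛ s
  ... | yes _   | yes _   = refl
  ... | no  _   | no  _   = refl
  ... | yes t≈s | no  u≉s = contradiction (Pw.trans Eq.trans (Pw.sym Eq.sym t≈u) t≈s) u≉s
  ... | no  t≉s | yes u≈s = contradiction (Pw.trans Eq.trans t≈u u≈s) t≉s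

  coeff-eval : ∀ {n} (z : FormalSum n) s → coeff z s ≡ eval z (indicator (elements s))
  coeff-eval []            s = refl
  coeff-eval ((a , t) ∷ z) s with elements t ≟ᵛ elements s
  ... | yes _ = cong₂ _+_ (sym (ℤ.*-identityʳ a)) (coeff-eval z s)
  ... | no  _ = cong₂ _+_ (sym (ℤ.*-zeroʳ a)) (coeff-eval z s)

  module Restriction {n p} {Q : Vec C n → Set p} (Q? : ∀ s → Dec (Q s)) where

    _∣Q _∣¬Q : Cochain n → Cochain n
    (g ∣Q)  s = if does (Q? s) then g s else 0ℤ
    (g ∣¬Q) s = if does (Q? s) then 0ℤ else g s

    select : FormalSum n → FormalSum n
    select = filter (λ (_ , s) → Q? (elements s))

    discard : FormalSum n → FormalSum n
    discard = filter (λ (_ , s) → ¬? (Q? (elements s)))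

    eval-select : ∀ z g → eval (select z) g ≡ eval z (g ∣Q)
    eval-select []            g = refl
    eval-select ((a , s) ∷ z) g with Q? (elements s)
    ... | yes _ = cong (a * g (elements s) +_) (eval-select z g)
    ... | no  _ = trans (eval-select z g) (sym (0-term a (eval z (g ∣Q))))

    eval-discard : ∀ z g → eval (discard z) g ≡ eval z (g ∣¬Q)
    eval-discard []            g = refl
    eval-discard ((a , s) ∷ z) g with Q? (elements s)
    ... | no  _ = cong (a * g (elements s) +_) (eval-discard z g)
    ... | yes _ = trans (eval-discard z g) (sym (0-term a (eval z (g ∣¬Q))))

    split : ∀ g s → g s ≡ (g ∣Q) s + (g ∣¬Q) s
    split g s with Q? s
    ... | yes _ = sym (ℤ.+-identityʳ (g s))
    ... | no  _ = sym (ℤ.+-identityˡ (g s))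

    eval-split : ∀ z g → eval z g ≡ eval (select z) g + eval (discard z) g
    eval-split z g = begin
      eval z g                               ≡⟨ eval-cong z (split g) ⟩
      eval z (λ s → (g ∣Q) s + (g ∣¬Q) s)    ≡⟨ eval-+ z (g ∣Q) (g ∣¬Q) ⟩
      eval z (g ∣Q) + eval z (g ∣¬Q)         ≡⟨ cong₂ _+_ (eval-select z g) (eval-discard z g) ⟨
      eval (select z) g + eval (discard z) g ∎
      where open ≡-Reasoning

    module _ (Q-resp : ∀ {s t} → s ≋ᵛ t → Q s → Q t) where

      ∣¬Q-resp : ∀ {g} → Respectful g → Respectful (g ∣¬Q)
      ∣¬Q-resp g-resp {s} {t} s≈t with Q? s | Q? t
      ... | yes _  | yes _  = refl
      ... | no  _  | no  _  = g-resp s≈t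
      ... | yes q  | no  ¬q = contradiction (Q-resp s≈t q) ¬q
      ... | no  ¬q | yes q  = contradiction (Q-resp (Pw.sym Eq.sym s≈t) q) ¬q

  -- The terms are grouped by simplex, along a list of simplices covering them.
  eval-∼[] : ∀ {n} (z : FormalSum n) → z ∼ [] → ∀ {g} → Respectful g → eval z g ≡ 0ℤ
  eval-∼[] {n} z z∼[] {g} g-resp = grouped (map proj₂ z) z (covered z) z∼[]
    where
    Covers : List (Chain n) → FormalSum n → Set (c ⊔ ℓ₁ ⊔ ℓ₂)
    Covers L = Supported (λ s → Any (λ t → s ≋ᵛ elements t) L)

    covered : ∀ w → Covers (map proj₂ w) w
    covered []      = []
    covered (_ ∷ w) = here (Pw.refl Eq.refl) ∷ All.map there (covered w)

    grouped : ∀ L w → Covers L w → w ∼ [] → eval w g ≡ 0ℤ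
    grouped []      []      _         _    = refl
    grouped []      (_ ∷ _) (() ∷ _)  _
    grouped (s ∷ L) w       w-covered w∼[] =
      trans (eval-split w g) (cong₂ _+_ selected
        (grouped L (discard w)
          (All.zipWith tail (All.all-filter _ w , All.filter⁺ _ w-covered)) discarded))
      where
      open Restriction {n} (_≟ᵛ elements s)

      tail : ∀ {t} → ¬ (t ≋ᵛ elements s) × Any (λ u → t ≋ᵛ elements u) (s ∷ L) →
             Any (λ u → t ≋ᵛ elements u) L
      tail (t≉s , here t≈s) = contradiction t≈s t≉s
      tail (t≉s , there i)  = i

      g∣s : ∀ t → (g ∣Q) t ≡ g (elements s) * indicator (elements s) t
      g∣s t with t ≟ᵛ elements s
      ... | yes t≈s = trans (g-resp t≈s) (sym (ℤ.*-identityʳ _))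
      ... | no  _   = sym (ℤ.*-zeroʳ (g (elements s)))

      selected : eval (select w) g ≡ 0ℤ
      selected = begin
        eval (select w) g             ≡⟨ eval-select w g ⟩
        eval w (g ∣Q)                 ≡⟨ eval-cong w g∣s ⟩
        eval w (λ t → gₛ * 1ₛ t)      ≡⟨ eval-* w gₛ 1ₛ ⟩
        gₛ * eval w 1ₛ                ≡⟨ cong (gₛ *_) (coeff-eval w s) ⟨
        gₛ * coeff w s                ≡⟨ cong (gₛ *_) (w∼[] s) ⟩
        gₛ * 0ℤ                       ≡⟨ ℤ.*-zeroʳ gₛ ⟩
        0ℤ                            ∎
        where
        open ≡-Reasoning
        gₛ = g (elements s)
        1ₛ = indicator (elements s)

      discarded : discard w ∼ []
      discarded t = trans (coeff-eval (discard w) t)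
        (trans (eval-discard w (indicator (elements t))) (vanishes (elements t ≟ᵛ elements s)))
        where
        vanishes : Dec (elements t ≋ᵛ elements s) → eval w (indicator (elements t) ∣¬Q) ≡ 0ℤ
        vanishes (yes t≈s) = trans (eval-cong w off) (eval-zero w)
          where
          off : ∀ u → (indicator (elements t) ∣¬Q) u ≡ 0ℤ
          off u with u ≟ᵛ elements s | u ≟ᵛ elements t
          ... | yes _   | _       = refl
          ... | no  _   | no  _   = refl
          ... | no  u≉s | yes u≈t = contradiction (Pw.trans Eq.trans u≈t t≈s) u≉s
        vanishes (no t≉s) = trans (eval-cong w off) (trans (sym (coeff-eval w t)) (w∼[] t))
          where
          off : ∀ u → (indicator (elements t) ∣¬Q) u ≡ indicator (elements t) u
          off u with u ≟ᵛ elements s | u ≟ᵛ elements t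
          ... | no  _   | _       = refl
          ... | yes _   | no  _   = refl
          ... | yes u≈s | yes u≈t = contradiction (Pw.trans Eq.trans (Pw.sym Eq.sym u≈t) u≈s) t≉s

  -- Upsets given by generators, and the vanishing of their homology.

  infix 4 _∈↑_ _∈↑?_

  _∈↑_ : C → List C → Set (c ⊔ ℓ₂)
  x ∈↑ D = Any (_≤ x) D

  _∈↑?_ : ∀ x D → Dec (x ∈↑ D)
  x ∈↑? D = any? (_≤? x) D

  ∈↑-up : ∀ {D x y} → x ≤ y → x ∈↑ D → y ∈↑ D
  ∈↑-up x≤y = Any.map (λ d≤x → ≤-trans d≤x x≤y)

  In : List C → ∀ {n} → Vec C n → Set (c ⊔ ℓ₂)
  In D = Allᵛ (_∈↑ D)

  In? : ∀ D {n} (s : Vec C n) → Dec (In D s)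
  In? D = Allᵛ.all? (_∈↑? D)

  In-resp : ∀ {D n} {s t : Vec C n} → s ≋ᵛ t → In D s → In D t
  In-resp []        []       = []
  In-resp (x≈y ∷ e) (i ∷ is) = ∈↑-up (≤-reflexive x≈y) i ∷ In-resp e is

  -- The later entries lie above the first. Hence every nonempty simplex of a union of two upsets
  -- lies in one of them, as Mayer-Vietoris requires.
  ascending-In : ∀ {D n x} {s : Vec C n} → AllPairs _<_ (x ∷ s) → x ∈↑ D → In D (x ∷ s)
  ascending-In (x<s ∷ _) i = i ∷ Allᵛ.map (λ (x≤y , _) → ∈↑-up x≤y i) x<s

  Supported-∂ : ∀ {p} {Q : Pred C p} {n} {z : FormalSum (suc n)} →
                Supported (Allᵛ Q) z → Supported (Allᵛ Q) (∂ z)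
  Supported-∂ []                         = []
  Supported-∂ {z = (a , s) ∷ _} (q ∷ qs) =
    All.++⁺ (All.tabulate⁺ {f = λ i → (a * -1ℤ ^ toℕ i , face i s)} λ i → All-removeAt i q)
            (Supported-∂ qs)

  -- The index counts vertices. At 0 only the empty simplex occurs, in dimension -1, where the
  -- reduced complex ends and every sum is a cycle.
  IsCycle : ∀ {n} → FormalSum n → Set (c ⊔ ℓ₁)
  IsCycle {zero}  z = ⊤
  IsCycle {suc n} z = ∀ (g : Cochain n) → Respectful g → eval z (δ g) ≡ 0ℤ

  _BoundaryOf_ : ∀ {n} → FormalSum n → FormalSum (suc n) → Set (c ⊔ ℓ₁)
  _BoundaryOf_ {n} z b = ∀ (g : Cochain n) → Respectful g → eval z g ≡ eval b (δ g)

  -- The reduced homology of the upset ↑D vanishes in dimension n - 1.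
  Acyclic : List C → ℕ → Set (c ⊔ ℓ₁ ⊔ ℓ₂)
  Acyclic D n = ∀ (z : FormalSum n) → Supported (In D) z → IsCycle z →
                ∃ λ (b : FormalSum (suc n)) → Supported (In D) b × z BoundaryOf b

  -- Contractibility of principal upsets.

  module Cone (y : C) where

    -- Dual to joining a simplex with the apex `y`, where simplices through `y` go to 0. Comparing
    -- `y` with the head suffices: in a chain of `↑y` no later entry equals `y`.
    prepend : ∀ {n} → Cochain (suc n) → Cochain n
    prepend g []      = g (y ∷ [])
    prepend g (x ∷ s) = if does (y ≟ x) then 0ℤ else g (y ∷ x ∷ s)

    prepend-≉ : ∀ {n} (g : Cochain (suc n)) {s} → Allᵛ (λ x → ¬ y ≈ x) s → prepend g s ≡ g (y ∷ s)
    prepend-≉ g []                 = refl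
    prepend-≉ g {x ∷ s} (y≉x ∷ _) with y ≟ x
    ... | yes y≈x = contradiction y≈x y≉x
    ... | no  _   = refl

    prepend-≈ : ∀ {n} (g : Cochain (suc (suc n))) {x} s → y ≈ x → prepend g (x ∷ s) ≡ 0ℤ
    prepend-≈ g {x} s y≈x with y ≟ x
    ... | yes _   = refl
    ... | no  y≉x = contradiction y≈x y≉x

    prepend-resp : ∀ {n} {g : Cochain (suc n)} → Respectful g → Respectful (prepend g)
    prepend-resp g-resp []                              = refl
    prepend-resp g-resp {x ∷ _} {x′ ∷ _} (x≈x′ ∷ e) with y ≟ x | y ≟ x′
    ... | yes _   | yes _    = refl
    ... | no  _   | no  _    = g-resp (Eq.refl ∷ x≈x′ ∷ e)
    ... | yes y≈x | no  y≉x′ = contradiction (Eq.trans y≈x x≈x′) y≉x′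
    ... | no  y≉x | yes y≈x′ = contradiction (Eq.trans y≈x′ (Eq.sym x≈x′)) y≉x

    -- The dual contracting homotopy. If the head is not `y`, then `δ g (y ∷ s)` is `g s` minus a
    -- sum over the faces that keep `y`, and the second summand restores that sum.
    homotopy : ∀ {n} {g : Cochain (suc n)} → Respectful g → (s : Chain (suc n)) →
               In [ y ] (elements s) →
               g (elements s) ≡ prepend (δ g) (elements s) + δ (prepend g) (elements s)
    homotopy {n} {g} g-resp (mkChain (x ∷ t) (x<t ∷ _)) (here y≤x ∷ _) = go (y ≟ x)
      where
      -- If the head is `y`, only the face without it counts: the other faces still begin with `y`,
      -- and `prepend g` is 0 there.
      apex : ∀ {n} {g : Cochain (suc n)} → Respectful g → (t : Vec C n) → Allᵛ (x <_) t →
             y ≈ x → g (x ∷ t) ≡ δ (prepend g) (x ∷ t)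
      apex g-resp []      []                 y≈x = g-resp (Eq.sym y≈x ∷ [])
      apex {g = g} g-resp t@(_ ∷ _) x<t y≈x = begin
        g (x ∷ t)
          ≡⟨ g-resp (Eq.sym y≈x ∷ Pw.refl Eq.refl) ⟩
        g (y ∷ t)
          ≡⟨ prepend-≉ g (Allᵛ.map (λ (_ , x≉u) y≈u → x≉u (Eq.trans (Eq.sym y≈x) y≈u)) x<t) ⟨
        prepend g t
          ≡⟨ ℤ.+-identityʳ (prepend g t) ⟨
        prepend g t + - 0ℤ
          ≡⟨ cong (λ a → prepend g t + - a) (δ-zero t) ⟨
        prepend g t + - δ (λ _ → 0ℤ) t
          ≡⟨ cong (λ a → prepend g t + - a) (δ-pointwise (λ u → prepend-≈ g u y≈x) t) ⟨
        prepend g t + - δ (prepend g ∘ (x ∷_)) t ∎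
        where open ≡-Reasoning

      go : Dec (y ≈ x) → g (x ∷ t) ≡ prepend (δ g) (x ∷ t) + δ (prepend g) (x ∷ t)
      go (yes y≈x) = trans (apex g-resp t x<t y≈x)
        (sym (trans (cong (_+ δ (prepend g) (x ∷ t)) (prepend-≈ (δ g) t y≈x)) (ℤ.+-identityˡ _)))
      go (no  y≉x) = begin
        g (x ∷ t)
          ≡⟨ lemma (g (x ∷ t)) (δ (g ∘ (y ∷_)) (x ∷ t)) ⟩
        g (x ∷ t) + - δ (g ∘ (y ∷_)) (x ∷ t) + δ (g ∘ (y ∷_)) (x ∷ t)
          ≡⟨ cong₂ _+_ (prepend-≉ (δ g) y≉s) (δ-cong (prepend-≉ g) y≉s) ⟨
        prepend (δ g) (x ∷ t) + δ (prepend g) (x ∷ t) ∎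
        where
        open ≡-Reasoning
        lemma : ∀ a b → a ≡ a + - b + b
        lemma = solve-∀
        y≉s : Allᵛ (λ u → ¬ y ≈ u) (x ∷ t)
        y≉s = y≉x ∷ Allᵛ.map (λ x<u → proj₂ (<-trans (y≤x , y≉x) x<u)) x<t

    cone : ∀ {n} (z : FormalSum (suc n)) → Supported (In [ y ]) z → FormalSum (suc (suc n))
    cone []                                          []                       = []
    cone ((a , mkChain (x ∷ s) (x<s ∷ asc)) ∷ z) ((here y≤x ∷ _) ∷ qs) with y ≟ x
    ... | yes _   = cone z qs
    ... | no  y≉x =
      (a , mkChain (y ∷ x ∷ s) ((y<x ∷ Allᵛ.map (<-trans y<x) x<s) ∷ x<s ∷ asc)) ∷ cone z qs
      where y<x = y≤x , y≉x

    cone-Supported : ∀ {n} (z : FormalSum (suc n)) (qs : Supported (In [ y ]) z) →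
                     Supported (In [ y ]) (cone z qs)
    cone-Supported []                                      []                   = []
    cone-Supported ((a , mkChain (x ∷ s) (x<s ∷ asc)) ∷ z) ((here y≤x ∷ q) ∷ qs) with y ≟ x
    ... | yes _ = cone-Supported z qs
    ... | no  _ = (here ≤-refl ∷ here y≤x ∷ q) ∷ cone-Supported z qs

    eval-cone : ∀ {n} (z : FormalSum (suc n)) (qs : Supported (In [ y ]) z) g →
                eval (cone z qs) g ≡ eval z (prepend g)
    eval-cone []                                      []                   g = refl
    eval-cone ((a , mkChain (x ∷ s) (x<s ∷ asc)) ∷ z) ((here y≤x ∷ q) ∷ qs) g with y ≟ x
    ... | yes _ = trans (eval-cone z qs g) (sym (0-term a (eval z (prepend g))))
    ... | no  _ = cong (a * g (y ∷ x ∷ s) +_) (eval-cone z qs g)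

    acyclic : ∀ {n} → Acyclic [ y ] (suc n)
    acyclic z qs z-cycle = cone z qs , cone-Supported z qs , λ g g-resp → begin
      eval z g
        ≡⟨ eval-cong-on qs (homotopy g-resp) ⟩
      eval z (λ s → prepend (δ g) s + δ (prepend g) s)
        ≡⟨ eval-+ z (prepend (δ g)) (δ (prepend g)) ⟩
      eval z (prepend (δ g)) + eval z (δ (prepend g))
        ≡⟨ cong₂ _+_ (sym (eval-cone z qs (δ g))) (z-cycle (prepend g) (prepend-resp g-resp)) ⟩
      eval (cone z qs) (δ g) + 0ℤ
        ≡⟨ ℤ.+-identityʳ _ ⟩
      eval (cone z qs) (δ g) ∎
      where open ≡-Reasoning

  -- Mayer-Vietoris for adjoining a principal upset.

  module MayerVietoris {y : C} {A I : List C}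
    (I⊆A : ∀ {x} → x ∈↑ I → x ∈↑ A) (I⊆y : ∀ {x} → x ∈↑ I → y ≤ x)
    (A∩y⊆I : ∀ {x} → y ≤ x → x ∈↑ A → x ∈↑ I) where

    -- Let `z₀` collect the simplices of `z` in `↑A` and `z₁` the others, which lie in `↑y`. The
    -- boundary of `z₁` is a cycle in the intersection `↑I`; if `v` in `↑I` has the same boundary,
    -- then `z₀ + v` and `z₁ - v` are cycles in `↑A` and in the cone `↑y`, and their fillings add up
    -- to one of `z`.
    acyclic : ∀ {n} → Acyclic A (suc n) → Acyclic I n → Acyclic (y ∷ A) (suc n)
    acyclic {n} A-acyclic I-acyclic z qs z-cycle =
      b₀ ++ b₁ ,
      All.++⁺ (All.map (Allᵛ.map there) (proj₁ (proj₂ bound₀)))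
              (All.map (Allᵛ.map weaken) (proj₁ (proj₂ bound₁))) ,
      λ g g-resp → begin
        eval z g
          ≡⟨ eval-split z g ⟩
        eval z₀ g + eval z₁ g
          ≡⟨ lemma (eval z₀ g) (eval z₁ g) (eval v g) ⟩
        eval z₀ g + eval v g + (eval z₁ g + - eval v g)
          ≡⟨ cong₂ _+_ (eval-++ z₀ v g) (eval-minus z₁ v g) ⟨
        eval (z₀ ++ v) g + eval (z₁ ++ negate v) g
          ≡⟨ cong₂ _+_ (proj₂ (proj₂ bound₀) g g-resp) (proj₂ (proj₂ bound₁) g g-resp) ⟩
        eval b₀ (δ g) + eval b₁ (δ g)
          ≡⟨ eval-++ b₀ b₁ (δ g) ⟨
        eval (b₀ ++ b₁) (δ g) ∎
      where
      open ≡-Reasoning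
      open Restriction {suc n} (In? A) using (eval-split; select; discard)
      module ∂R = Restriction {n} (In? A)

      lemma : ∀ a b c → a + b ≡ a + c + (b + - c)
      lemma = solve-∀

      weaken : ∀ {x} → x ∈↑ [ y ] → x ∈↑ y ∷ A
      weaken (here y≤x) = here y≤x

      z₀ z₁ : FormalSum (suc n)
      z₀ = select z
      z₁ = discard z

      z₀-in : Supported (In A) z₀
      z₀-in = All.all-filter _ z

      z₁-in : Supported (In [ y ]) z₁
      z₁-in = All.zipWith (λ { {_ , s} (¬A , yA) → above s ¬A yA })
        (All.all-filter _ z , All.filter⁺ _ qs)
        where
        above : (s : Chain (suc n)) → ¬ In A (elements s) → In (y ∷ A) (elements s) →
                In [ y ] (elements s)
        above (mkChain (x ∷ t) asc) ¬A (here y≤x ∷ _) = ascending-In asc (here y≤x)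
        above (mkChain (x ∷ t) asc) ¬A (there x∈A ∷ _) = contradiction (ascending-In asc x∈A) ¬A

      split-cycle : ∀ g → Respectful g → eval z₀ (δ g) + eval z₁ (δ g) ≡ 0ℤ
      split-cycle g g-resp = trans (sym (eval-split z (δ g))) (z-cycle g g-resp)

      -- The terms of `∂ z₁` outside `↑A` cancel but are still listed, so they are dropped to make
      -- `w` supported in `↑I`.
      w : FormalSum n
      w = ∂R.select (∂ z₁)

      w-in : Supported (In I) w
      w-in = All.zipWith (Allᵛ.map (λ { (x∈A , here y≤x) → A∩y⊆I y≤x x∈A }) ∘ Allᵛ.zip)
        (All.all-filter _ (∂ z₁) , All.filter⁺ _ (Supported-∂ z₁-in))

      -- The cycle condition is tested on `g` set to 0 on simplices of `↑A`. This annihilates the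
      -- boundary of `z₀`, as faces of its simplices stay in `↑A`, and therefore that of `z₁`.
      vanishes-off-A : ∀ g → Respectful g → eval (∂R.discard (∂ z₁)) g ≡ 0ℤ
      vanishes-off-A g g-resp = begin
        eval (∂R.discard (∂ z₁)) g
          ≡⟨ ∂R.eval-discard (∂ z₁) g ⟩
        eval (∂ z₁) g′
          ≡⟨ eval-∂ z₁ g′ ⟩
        eval z₁ (δ g′)
          ≡⟨ ℤ.+-identityˡ _ ⟨
        0ℤ + eval z₁ (δ g′)
          ≡⟨ cong (_+ eval z₁ (δ g′)) (eval-zero z₀) ⟨
        eval z₀ (λ _ → 0ℤ) + eval z₁ (δ g′)
          ≡⟨ cong (_+ eval z₁ (δ g′)) (eval-cong-on z₀-in vanishes) ⟨
        eval z₀ (δ g′) + eval z₁ (δ g′)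
          ≡⟨ split-cycle g′ (∂R.∣¬Q-resp In-resp g-resp) ⟩
        0ℤ ∎
        where
        g′ : Cochain n
        g′ = g ∂R.∣¬Q
        off : ∀ {s} → In A s → g′ s ≡ 0ℤ
        off {s} i with In? A s
        ... | yes _  = refl
        ... | no  ¬i = contradiction i ¬i
        vanishes : ∀ (s : Chain (suc n)) → In A (elements s) → δ g′ (elements s) ≡ 0ℤ
        vanishes s i = trans (δ-cong off i) (δ-zero (elements s))

      eval-w : ∀ g → Respectful g → eval w g ≡ eval z₁ (δ g)
      eval-w g g-resp = begin
        eval w g                               ≡⟨ ℤ.+-identityʳ _ ⟨
        eval w g + 0ℤ                          ≡⟨ cong (eval w g +_) (vanishes-off-A g g-resp) ⟨
        eval w g + eval (∂R.discard (∂ z₁)) g  ≡⟨ ∂R.eval-split (∂ z₁) g ⟨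
        eval (∂ z₁) g                          ≡⟨ eval-∂ z₁ g ⟩
        eval z₁ (δ g)                          ∎

      bound : ∃ λ (v : FormalSum (suc n)) → Supported (In I) v × w BoundaryOf v
      bound = I-acyclic w w-in (image-cycle z₁ w eval-w)
        where
        image-cycle : ∀ {n} (u : FormalSum (suc n)) (w : FormalSum n) →
                      (∀ g → Respectful g → eval w g ≡ eval u (δ g)) → IsCycle w
        image-cycle {zero}  u w w∼∂u          = tt
        image-cycle {suc n} u w w∼∂u g g-resp =
          trans (w∼∂u (δ g) (δ-resp g-resp)) (trans (eval-cong u (δ∘δ g)) (eval-zero u))

      v : FormalSum (suc n)
      v = proj₁ bound

      eval-v : ∀ g → Respectful g → eval v (δ g) ≡ eval z₁ (δ g)
      eval-v g g-resp = trans (sym (proj₂ (proj₂ bound) g g-resp)) (eval-w g g-resp)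

      bound₀ : ∃ λ (b : FormalSum (suc (suc n))) → Supported (In A) b × (z₀ ++ v) BoundaryOf b
      bound₀ = A-acyclic (z₀ ++ v)
        (All.++⁺ z₀-in (All.map (Allᵛ.map I⊆A) (proj₁ (proj₂ bound)))) λ g g-resp →
        trans (eval-++ z₀ v (δ g))
          (trans (cong (eval z₀ (δ g) +_) (eval-v g g-resp)) (split-cycle g g-resp))

      bound₁ : ∃ λ (b : FormalSum (suc (suc n))) →
               Supported (In [ y ]) b × (z₁ ++ negate v) BoundaryOf b
      bound₁ = Cone.acyclic y (z₁ ++ negate v)
        (All.++⁺ z₁-in (All.map⁺ (All.map (Allᵛ.map (here ∘ I⊆y)) (proj₁ (proj₂ bound)))))
        λ g g-resp → trans (eval-minus z₁ v (δ g))
          (trans (cong (λ a → eval z₁ (δ g) + - a) (eval-v g g-resp))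
                 (ℤ.+-inverseʳ (eval z₁ (δ g))))

      b₀ b₁ : FormalSum (suc (suc n))
      b₀ = proj₁ bound₀
      b₁ = proj₁ bound₁

  Acyclic-≗ : ∀ {A B n} → (∀ {x} → x ∈↑ A → x ∈↑ B) → (∀ {x} → x ∈↑ B → x ∈↑ A) →
              Acyclic A n → Acyclic B n
  Acyclic-≗ A⊆B B⊆A A-acyclic z qs z-cycle =
    let b , b-in , bounds = A-acyclic z (All.map (Allᵛ.map B⊆A) qs) z-cycle
    in  b , All.map (Allᵛ.map A⊆B) b-in , bounds

  -- This is dimension -1: the empty simplex is the boundary of the vertex `x`.
  nonempty-acyclic : ∀ x D → Acyclic (x ∷ D) 0
  nonempty-acyclic x D z _ _ =
    map cone z , All.map⁺ (All.universal (λ _ → here ≤-refl ∷ []) z) , bounds z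
    where
    cone : ℤ × Chain 0 → ℤ × Chain 1
    cone (a , _) = a , mkChain (x ∷ []) ([] ∷ [])
    bounds : ∀ z → z BoundaryOf map cone z
    bounds []                        g g-resp = refl
    bounds ((a , mkChain [] _) ∷ z) g g-resp = cong (a * g [] +_) (bounds z g g-resp)

  -- Unions of few principal upsets when bounded pairs have joins.

  IsJoin : C → C → C → Set (c ⊔ ℓ₂)
  IsJoin x y j = x ≤ j × y ≤ j × (∀ {z} → x ≤ z → y ≤ z → j ≤ z)

  HasBoundedJoins : Set (c ⊔ ℓ₂)
  HasBoundedJoins = ∀ x y → ∃ (IsJoin x y) ⊎ (∀ {z} → x ≤ z → ¬ y ≤ z)

  module Crosscut (join : HasBoundedJoins) where

    joins : C → List C → List C
    joins y []      = []
    joins y (d ∷ D) with join y d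
    ... | inj₁ (j , _) = j ∷ joins y D
    ... | inj₂ _       = joins y D

    length-joins : ∀ y D → length (joins y D) ℕ.≤ length D
    length-joins y []      = z≤n
    length-joins y (d ∷ D) with join y d
    ... | inj₁ _ = s≤s (length-joins y D)
    ... | inj₂ _ = ℕ.m≤n⇒m≤1+n (length-joins y D)

    joins⊆D : ∀ {y} D {x} → x ∈↑ joins y D → x ∈↑ D
    joins⊆D {y} (d ∷ D) i with join y d | i
    ... | inj₁ (j , _ , d≤j , _) | here j≤x = here (≤-trans d≤j j≤x)
    ... | inj₁ _                 | there i′ = there (joins⊆D D i′)
    ... | inj₂ _                 | i′       = there (joins⊆D D i′)

    joins⊆y : ∀ {y} D {x} → x ∈↑ joins y D → y ≤ x
    joins⊆y {y} (d ∷ D) i with join y d | i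
    ... | inj₁ (j , y≤j , _) | here j≤x = ≤-trans y≤j j≤x
    ... | inj₁ _             | there i′ = joins⊆y D i′
    ... | inj₂ _             | i′       = joins⊆y D i′

    ⊆joins : ∀ {y} D {x} → y ≤ x → x ∈↑ D → x ∈↑ joins y D
    ⊆joins {y} (d ∷ D) y≤x i with join y d | i
    ... | inj₁ (j , _ , _ , least) | here d≤x = here (least y≤x d≤x)
    ... | inj₁ _                   | there i′ = there (⊆joins D y≤x i′)
    ... | inj₂ unbounded           | here d≤x = contradiction d≤x (unbounded y≤x)
    ... | inj₂ _                   | there i′ = ⊆joins D y≤x i′

    -- Mayer-Vietoris for adjoining `d` to `D`: the upset `↑D` has one generator fewer, and its
    -- intersection with `↑d`, generated by `joins d D`, has no more generators than `D` and is
    -- needed only one dimension lower. A single generator gives a cone.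
    acyclic : ∀ n D → length D ℕ.≤ suc n → Acyclic D (suc n)
    acyclic n       []          _         []                          _              _ =
      [] , [] , λ _ _ → refl
    acyclic n       []          _         ((_ , mkChain (_ ∷ _) _) ∷ _) ((() ∷ _) ∷ _)
    acyclic zero    (d ∷ [])    _         = Cone.acyclic d
    acyclic zero    (_ ∷ _ ∷ _) (s≤s ())
    acyclic (suc n) (d ∷ D)     (s≤s |D|≤1+n) =
      MayerVietoris.acyclic (joins⊆D D) (joins⊆y D) (⊆joins D)
        (acyclic (suc n) D (ℕ.m≤n⇒m≤1+n |D|≤1+n))
        (acyclic n (joins d D) (ℕ.≤-trans (length-joins d D) |D|≤1+n))

-- Maximal chains of upsets.

module MaximalChains {c ℓ₁ ℓ₂ : Level} (P : DecPoset c ℓ₁ ℓ₂) where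

  open DecPoset P using (_≈_; _≤_; _≟_; _≤?_; module Eq; antisym)
    renaming (Carrier to C; trans to ≤-trans; refl to ≤-refl; reflexive to ≤-reflexive)
  open PosetProperties (DecPoset.poset P) using (_<_; <-respˡ-≈; <-respʳ-≈; <⇒≱)
  open OrderComplex P hiding (size; chain; maximal)
  open Homology P

  open VecMembership Eq.setoid using () renaming (_∈_ to _∈ᵛ_)
  open ListMembership Eq.setoid using (_∈_)

  _<?_ : ∀ x y → Dec (x < y)
  x <? y = (x ≤? y) ×-dec ¬? (x ≟ y)

  _⊆↑_ : List C → List C → Set (c ⊔ ℓ₂)
  A ⊆↑ B = ∀ {x} → x ∈↑ A → x ∈↑ B

  lookup-< : ∀ {n y x} {s : Vec C n} → Allᵛ (y <_) s → x ∈ᵛ s → y < x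
  lookup-< y<s = Allᵛ.lookupₛ Eq.setoid <-respʳ-≈ y<s

  lookup-In : ∀ {n D x} {s : Vec C n} → In D s → x ∈ᵛ s → x ∈↑ D
  lookup-In s-in = Allᵛ.lookupₛ Eq.setoid (λ x≈y → ∈↑-up (≤-reflexive x≈y)) s-in

  tabulateᵛ : ∀ {p n} {Q : C → Set p} (s : Vec C n) → (∀ {x} → x ∈ᵛ s → Q x) → Allᵛ Q s
  tabulateᵛ []      q = []
  tabulateᵛ (x ∷ s) q = q (here Eq.refl) ∷ tabulateᵛ s (q ∘ there)

  comparable : ∀ {n x y} {s : Vec C n} → AllPairs _<_ s → x ∈ᵛ s → y ∈ᵛ s → x ≤ y ⊎ y ≤ x
  comparable _           (here x≈u)  (here y≈u)  = inj₁ (≤-reflexive (Eq.trans x≈u (Eq.sym y≈u)))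
  comparable (u<s ∷ _)   (here x≈u)  (there y∈s) =
    inj₁ (proj₁ (<-respˡ-≈ (Eq.sym x≈u) (lookup-< u<s y∈s)))
  comparable (u<s ∷ _)   (there x∈s) (here y≈u)  =
    inj₂ (proj₁ (<-respˡ-≈ (Eq.sym y≈u) (lookup-< u<s x∈s)))
  comparable (_ ∷ s-asc) (there x∈s) (there y∈s) = comparable s-asc x∈s y∈s

  -- Maximality is among the chains of `↑D` only, so that chains can be built up from smaller
  -- upsets. The bound on `size` means length at least n - 1, the dimension in `Acyclic D n`.
  record LongChain (D : List C) (n : ℕ) : Set (c ⊔ ℓ₁ ⊔ ℓ₂) where
    field
      {size}    : ℕ
      chain     : Chain size
      contained : In D (elements chain)
      maximal   : ∀ {m} (t : Chain m) → In D (elements t) → chain ⊑ t → t ⊑ chain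
      long      : n ℕ.≤ size

  open LongChain

  ManyChains : List C → ℕ → Set (c ⊔ ℓ₁ ⊔ ℓ₂)
  ManyChains D n = Σ (Fin (suc n !) → LongChain D n) λ f →
    ∀ {i j} → chain (f i) ⊑ chain (f j) → chain (f j) ⊑ chain (f i) → i ≡ j

  LongChain-≗ : ∀ {A B n} → A ⊆↑ B → B ⊆↑ A → LongChain A n → LongChain B n
  LongChain-≗ A⊆B B⊆A c = record
    { chain     = chain c
    ; contained = Allᵛ.map A⊆B (contained c)
    ; maximal   = λ t t-in → maximal c t (Allᵛ.map B⊆A t-in)
    ; long      = long c
    }

  ManyChains-≗ : ∀ {A B n} → A ⊆↑ B → B ⊆↑ A → ManyChains A n → ManyChains B n
  ManyChains-≗ A⊆B B⊆A (f , f-injective) = LongChain-≗ A⊆B B⊆A ∘ f , f-injective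

  adjoin : ∀ {n} (y : C) (s : Chain n) → Allᵛ (y <_) (elements s) → Chain (suc n)
  adjoin y (mkChain s asc) y<s = mkChain (y ∷ s) (y<s ∷ asc)

  adjoin-cancel : ∀ {m n y} {s : Chain m} {t : Chain n} y<s y<t →
                  adjoin y s y<s ⊑ adjoin y t y<t → s ⊑ t
  adjoin-cancel y<s y<t s⊑t x∈s with s⊑t (there x∈s)
  ... | here x≈y  = contradiction (Eq.sym x≈y) (proj₂ (lookup-< y<s x∈s))
  ... | there x∈t = x∈t

  -- A chain `t` of `↑B` containing the new one has a head at most `y`, hence equal to `y` by
  -- minimality. Its tail lies in `↑A` and contains `s`, so maximality of `s` applies. Below, `A` is
  -- either the link of `y` or the rest of the upset.
  extend : ∀ {y A B n} → y ∈↑ B → A ⊆↑ B → (∀ {x} → x ∈↑ B → x ≤ y → y ≤ x) →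
           (∀ {x} → x ∈↑ B → y < x → x ∈↑ A) →
           (s : LongChain A n) → Allᵛ (y <_) (elements (chain s)) → LongChain B (suc n)
  extend {y} {A} {B} y∈B A⊆B y-minimal above s y<s = record
    { chain     = adjoin y (chain s) y<s
    ; contained = y∈B ∷ Allᵛ.map A⊆B (contained s)
    ; maximal   = max
    ; long      = s≤s (long s)
    }
    where
    max : ∀ {m} (t : Chain m) → In B (elements t) →
          adjoin y (chain s) y<s ⊑ t → t ⊑ adjoin y (chain s) y<s
    max (mkChain [] _) _ y∷s⊑t with () ← y∷s⊑t (here Eq.refl)
    max (mkChain (u ∷ t) (u<t ∷ t-asc)) (u∈B ∷ t∈B) y∷s⊑t = t⊑y∷s
      where
      u≤y : u ≤ y
      u≤y with y∷s⊑t (here Eq.refl)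
      ... | here y≈u  = ≤-reflexive (Eq.sym y≈u)
      ... | there y∈t = proj₁ (lookup-< u<t y∈t)
      u≈y : u ≈ y
      u≈y = antisym u≤y (y-minimal u∈B u≤y)
      t∈A : In A t
      t∈A = Allᵛ.map (λ (x∈B , u<x) → above x∈B (<-respˡ-≈ u≈y u<x)) (Allᵛ.zip (t∈B , u<t))
      s⊑t : chain s ⊑ mkChain t t-asc
      s⊑t x∈s with y∷s⊑t (there x∈s)
      ... | here x≈u  = contradiction (Eq.sym (Eq.trans x≈u u≈y)) (proj₂ (lookup-< y<s x∈s))
      ... | there x∈t = x∈t
      t⊑y∷s : mkChain (u ∷ t) (u<t ∷ t-asc) ⊑ adjoin y (chain s) y<s
      t⊑y∷s (here x≈u)  = here (Eq.trans x≈u u≈y)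
      t⊑y∷s (there x∈t) = there (maximal s (mkChain t t-asc) t∈A s⊑t x∈t)

  -- Adding a minimal element.

  module AddMinimal {y A} (y∉A : ¬ y ∈↑ A) (above : ∀ {x} → y < x → x ∈↑ A) where

    minimal : ∀ {x} → x ∈↑ y ∷ A → x ≤ y → y ≤ x
    minimal (here y≤x)  _   = y≤x
    minimal (there x∈A) x≤y = contradiction (∈↑-up x≤y x∈A) y∉A

    y≉A : ∀ {x} → x ∈↑ A → ¬ y ≈ x
    y≉A x∈A y≈x = y∉A (∈↑-up (≤-reflexive (Eq.sym y≈x)) x∈A)

    -- If `y` lies below all of `s`, it is put in front; otherwise `s` is maximal already. The
    -- result differs from `s` by at most `y`, so `s` can be recovered and distinct chains stay
    -- distinct.
    lift : ∀ {n} (s : LongChain A n) → ∃ λ (t : LongChain (y ∷ A) n) →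
           chain s ⊑ chain t × (∀ {x} → x ∈ᵛ elements (chain t) → ¬ y ≈ x → x ∈ᵛ elements (chain s))
    lift s with Allᵛ.all? (y <?_) (elements (chain s))
    ... | yes y<s = record
      { chain     = chain t
      ; contained = contained t
      ; maximal   = maximal t
      ; long      = ℕ.m≤n⇒m≤1+n (long s)
      } , there , λ { (here x≈y) y≉x → contradiction (Eq.sym x≈y) y≉x ; (there x∈s) _ → x∈s }
      where
      t = extend (here ≤-refl) there minimal (λ _ → above) s y<s
    ... | no  y≮s = record
      { chain     = chain s
      ; contained = Allᵛ.map there (contained s)
      ; maximal   = λ t t-in s⊑t → maximal s t (tabulateᵛ (elements t) (avoids t t-in s⊑t)) s⊑t
      ; long      = long s
      } , id , λ x∈s _ → x∈s
      where
      avoids : ∀ {m} (t : Chain m) → In (y ∷ A) (elements t) → chain s ⊑ t →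
               ∀ {x} → x ∈ᵛ elements t → x ∈↑ A
      avoids t t-in s⊑t {x} x∈t with lookup-In t-in x∈t | y ≟ x
      ... | there x∈A | _       = x∈A
      ... | here y≤x  | no  y≉x = above (y≤x , y≉x)
      ... | here y≤x  | yes y≈x = contradiction (tabulateᵛ _ y<s) y≮s
        where
        -- Each `u` in `s` is comparable with `y`, as both lie on `t`, and `u ≤ y` would put `y`
        -- into `↑A`. So `y` is below all of `s`, the case excluded here.
        y<s : ∀ {u} → u ∈ᵛ elements (chain s) → y < u
        y<s u∈s with comparable (ascending t) x∈t (s⊑t u∈s)
        ... | inj₁ x≤u = ≤-trans y≤x x≤u , y≉A (lookup-In (contained s) u∈s)
        ... | inj₂ u≤x = contradiction
          (∈↑-up (≤-trans u≤x (≤-reflexive (Eq.sym y≈x))) (lookup-In (contained s) u∈s)) y∉A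

    manyChains : ∀ {n} → ManyChains A n → ManyChains (y ∷ A) n
    manyChains (f , f-injective) =
      proj₁ ∘ lift ∘ f , λ i⊑j j⊑i → f-injective (restrict i⊑j) (restrict j⊑i)
      where
      restrict : ∀ {n} {s t : LongChain A n} →
                 chain (proj₁ (lift s)) ⊑ chain (proj₁ (lift t)) → chain s ⊑ chain t
      restrict {s = s} {t} s⊑t x∈s = proj₂ (proj₂ (lift t))
        (s⊑t (proj₁ (proj₂ (lift s)) x∈s)) (y≉A (lookup-In (contained s) x∈s))

  IsLink : C → List C → Set (c ⊔ ℓ₁ ⊔ ℓ₂)
  IsLink y L = (∀ {x} → x ∈↑ L → y < x) × (∀ {x} → y < x → x ∈↑ L)

  -- Comparing positions rather than elements also rules out repetitions.
  Antichain : List C → Set ℓ₂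
  Antichain D = ∀ i j → lookup D i ≤ lookup D j → i ≡ j

  LongLinks : List C → ℕ → Set (c ⊔ ℓ₁ ⊔ ℓ₂)
  LongLinks D n = All (λ d → ∃ λ L → IsLink d L × ManyChains L n) D

  -- Chains through the members of an antichain.

  module Fan {D : List C} {n : ℕ} (n<|D| : suc (suc n) ℕ.≤ length D)
             (antichain : Antichain D) (links : LongLinks D n) where

    -- Only the first n + 2 members of `D` are used, to obtain exactly (n + 2)! chains.
    vertex : Fin (suc (suc n)) → C
    vertex q = lookup D (inject≤ q n<|D|)

    link : ∀ q → ∃ λ L → IsLink (vertex q) L × ManyChains L n
    link q = All.lookup links (∈ᴸ.∈-lookup (inject≤ q n<|D|))

    vertex∈D : ∀ q → vertex q ∈↑ D
    vertex∈D q = Any.map (λ e → ≤-reflexive (Eq.reflexive (sym e))) (∈ᴸ.∈-lookup (inject≤ q n<|D|))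

    minimal : ∀ q {x} → x ∈↑ D → x ≤ vertex q → vertex q ≤ x
    minimal q x∈D x≤q =
      subst (λ i → lookup D i ≤ _)
        (antichain (Any.index x∈D) _ (≤-trans (Any.lookup-index x∈D) x≤q))
        (Any.lookup-index x∈D)

    subchain : ∀ q → Fin (suc n !) → LongChain (proj₁ (link q)) n
    subchain q = proj₁ (proj₂ (proj₂ (link q)))

    vertex<subchain : ∀ q r → Allᵛ (vertex q <_) (elements (chain (subchain q r)))
    vertex<subchain q r = Allᵛ.map (proj₁ (proj₁ (proj₂ (link q)))) (contained (subchain q r))

    chainThrough : Fin (suc (suc n)) → Fin (suc n !) → LongChain D (suc n)
    chainThrough q r = extend (vertex∈D q)
      (λ x∈L → ∈↑-up (proj₁ (proj₁ (proj₁ (proj₂ (link q))) x∈L)) (vertex∈D q))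
      (minimal q) (λ _ → proj₂ (proj₁ (proj₂ (link q))))
      (subchain q r) (vertex<subchain q r)

    -- A vertex is the least element of its chain. As `D` is an antichain, the chain thus determines
    -- the vertex.
    vertex≤ : ∀ {q q′ r r′} → chain (chainThrough q r) ⊑ chain (chainThrough q′ r′) →
              vertex q′ ≤ vertex q
    vertex≤ {q′ = q′} {r′ = r′} s⊑t with s⊑t (here Eq.refl)
    ... | here q≈q′ = ≤-reflexive (Eq.sym q≈q′)
    ... | there q∈t = proj₁ (lookup-< (vertex<subchain q′ r′) q∈t)

    chainThrough-injective : ∀ {q q′ r r′} → chain (chainThrough q r) ⊑ chain (chainThrough q′ r′) →
                             chain (chainThrough q′ r′) ⊑ chain (chainThrough q r) → q ≡ q′ × r ≡ r′
    chainThrough-injective {q} {q′} {r} {r′} s⊑t t⊑s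
      with refl ← Fin.inject≤-injective n<|D| n<|D| q q′
                    (antichain _ _ (vertex≤ {q′} {q} {r′} {r} t⊑s)) =
      refl , proj₂ (proj₂ (proj₂ (link q))) (cancel r r′ s⊑t) (cancel r′ r t⊑s)
      where
      cancel : ∀ r r′ → chain (chainThrough q r) ⊑ chain (chainThrough q r′) →
               chain (subchain q r) ⊑ chain (subchain q r′)
      cancel r r′ = adjoin-cancel {s = chain (subchain q r)} {chain (subchain q r′)}
                      (vertex<subchain q r) (vertex<subchain q r′)

    manyChains : ManyChains D (suc n)
    -- The factorial unfolds to `suc (suc n) * suc n !`, so `remQuot` reads an index as a vertex and
    -- a chain in its link.
    manyChains = uncurry chainThrough ∘ remQuot (suc n !) , λ {i} {j} i⊑j j⊑i →
      let q≡q′ , r≡r′ = chainThrough-injective {proj₁ (remQuot (suc n !) i)} i⊑j j⊑i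
      in  trans (sym (Fin.combine-remQuot (suc n !) i))
            (trans (cong₂ combine q≡q′ r≡r′) (Fin.combine-remQuot (suc n !) j))

  -- A sorted closed list enumerates an upset along a linear extension, so its head is minimal.
  Sorted : List C → Set (c ⊔ ℓ₂)
  Sorted = ListAllPairs (λ x y → ¬ y ≤ x)

  Closed : List C → Set (c ⊔ ℓ₁ ⊔ ℓ₂)
  Closed X = ∀ {x} → x ∈↑ X → x ∈ X

  ∈⇒∈↑ : ∀ {x X} → x ∈ X → x ∈↑ X
  ∈⇒∈↑ = Any.map (≤-reflexive ∘ Eq.sym)

  sorted-∉ : ∀ {y X} → Sorted (y ∷ X) → ¬ y ∈↑ X
  sorted-∉ (y≱X ∷ _) y∈X = All.All¬⇒¬Any y≱X y∈X

  closed-above : ∀ {y X} → Closed (y ∷ X) → ∀ {x} → y < x → x ∈ X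
  closed-above closed (y≤x , y≉x) with closed (here y≤x)
  ... | here x≈y  = contradiction (Eq.sym x≈y) y≉x
  ... | there x∈X = x∈X

  closed-tail : ∀ {y X} → Sorted (y ∷ X) → Closed (y ∷ X) → Closed X
  closed-tail sorted closed x∈X with closed (there x∈X)
  ... | here x≈y  = contradiction (∈↑-up (≤-reflexive x≈y) x∈X) (sorted-∉ sorted)
  ... | there x∈X = x∈X

  -- Examination of the minimal elements.

  module _ (join : HasBoundedJoins) where

    Outcome : List C → ℕ → Set (c ⊔ ℓ₁ ⊔ ℓ₂)
    Outcome D n = ManyChains D n ⊎ Acyclic D n

    Outcome-≗ : ∀ {A B n} → A ⊆↑ B → B ⊆↑ A → Outcome A n → Outcome B n
    Outcome-≗ A⊆B B⊆A = ⊎-map (ManyChains-≗ A⊆B B⊆A) (Acyclic-≗ A⊆B B⊆A)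

    -- ys lists the elements still to be examined, D the minimal elements of ↑(D ++ ys) whose link
    -- is already known to have many long chains.
    sweep : ∀ {n} → (∀ X → Sorted X → Closed X → Outcome X n) →
            ∀ D ys → Antichain D → LongLinks D n → All (λ y → All (λ d → ¬ y ≤ d) D) ys →
            Sorted ys → Closed ys → Outcome (D ++ ys) (suc n)
    sweep {n} rec D [] antichain links _ _ _ =
      Outcome-≗ Any.++⁺ˡ (λ i → [ id , (λ ()) ]′ (Any.++⁻ D i)) base
      where
      -- Only the upset `↑D` is left: at most n + 1 generators leave no homology, and n + 2 or more
      -- start enough chains.
      base : Outcome D (suc n)
      base with length D ℕ.≤? suc n
      ... | yes |D|≤1+n = inj₂ (Crosscut.acyclic join n D |D|≤1+n)
      ... | no  |D|≰1+n = inj₁ (Fan.manyChains (ℕ.≰⇒> |D|≰1+n) antichain links)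
    sweep {n} rec D (y ∷ ys) antichain links (y≰D ∷ ys≰D) sorted@(_ ∷ ys-sorted) closed with y ∈↑? D
    -- Lying above a member of `D`, `y` is not minimal and adds nothing to the upset.
    ... | yes y∈D = Outcome-≗ (λ i → [ Any.++⁺ˡ , Any.++⁺ʳ D ∘ there ]′ (Any.++⁻ D i)) absorb
                      (sweep rec D ys antichain links ys≰D ys-sorted (closed-tail sorted closed))
      where
      absorb : (D ++ y ∷ ys) ⊆↑ (D ++ ys)
      absorb i with Any.++⁻ D i
      ... | inj₁ x∈D          = Any.++⁺ˡ x∈D
      ... | inj₂ (here y≤x)   = Any.++⁺ˡ (∈↑-up y≤x y∈D)
      ... | inj₂ (there x∈ys) = Any.++⁺ʳ D x∈ys
    -- Now `y` is minimal in the remaining upset, and its link `L` is settled one dimension lower.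
    ... | no y∉D =
      Outcome-≗ move⁺ move⁻ (examine (rec L (ListAllPairs.filter⁺ (y <?_) ys-sorted) L-closed))
      where
      ys-closed : Closed ys
      ys-closed = closed-tail sorted closed

      L : List C
      L = filter (y <?_) ys

      ∈L : ∀ {x} → y < x → x ∈ L
      ∈L y<x = ∈-filter⁺ Eq.setoid (y <?_) <-respʳ-≈ (closed-above closed y<x) y<x

      L⊆ys : L ⊆↑ ys
      L⊆ys i = Any.filter⁻ (y <?_) i

      L-above : ∀ {x} → x ∈↑ L → y < x
      L-above i = let y<e , e≤x = All.lookupAny (All.all-filter (y <?_) ys) i
                  in  ≤-trans (proj₁ y<e) e≤x ,
                      λ y≈x → <⇒≱ y<e (≤-trans e≤x (≤-reflexive (Eq.sym y≈x)))

      L-closed : Closed L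
      L-closed i = ∈L (L-above i)

      y∉D++ys : ¬ y ∈↑ D ++ ys
      y∉D++ys i = [ y∉D , sorted-∉ sorted ]′ (Any.++⁻ D i)

      move⁺ : (y ∷ D ++ ys) ⊆↑ (D ++ y ∷ ys)
      move⁺ (here y≤x) = Any.++⁺ʳ D (here y≤x)
      move⁺ (there i)  = [ Any.++⁺ˡ , Any.++⁺ʳ D ∘ there ]′ (Any.++⁻ D i)

      move⁻ : (D ++ y ∷ ys) ⊆↑ (y ∷ D ++ ys)
      move⁻ i with Any.++⁻ D i
      ... | inj₁ x∈D          = there (Any.++⁺ˡ x∈D)
      ... | inj₂ (here y≤x)   = here y≤x
      ... | inj₂ (there x∈ys) = there (Any.++⁺ʳ D x∈ys)

      y∷D-antichain : Antichain (y ∷ D)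
      y∷D-antichain zero    zero    _   = refl
      y∷D-antichain zero    (suc j) y≤d = contradiction y≤d (All.lookup y≰D (∈ᴸ.∈-lookup j))
      y∷D-antichain (suc i) zero    d≤y =
        contradiction (Any.map (λ e → subst (_≤ y) e d≤y) (∈ᴸ.∈-lookup i)) y∉D
      y∷D-antichain (suc i) (suc j) d≤e = cong suc (antichain i j d≤e)

      examine : Outcome L n → Outcome (y ∷ D ++ ys) (suc n)
      examine (inj₁ many) = sweep rec (y ∷ D) ys y∷D-antichain
        ((L , (L-above , ∈⇒∈↑ ∘ ∈L) , many) ∷ links)
        (All.zipWith (λ (a , b) → a ∷ b) (ListAllPairs.head sorted , ys≰D)) ys-sorted ys-closed
      -- With an acyclic link, `y` is set aside and either outcome for the rest carries over. For
      -- Mayer-Vietoris, an element of the rest above `y` differs from `y`, so `↑y` meets the rest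
      -- exactly in the link.
      examine (inj₂ L-acyclic) with sweep rec D ys antichain links ys≰D ys-sorted ys-closed
      ... | inj₁ many    = inj₁ (AddMinimal.manyChains y∉D++ys
        (Any.++⁺ʳ D ∘ ∈⇒∈↑ ∘ closed-above closed) many)
      ... | inj₂ acyclic = inj₂ (MayerVietoris.acyclic (Any.++⁺ʳ D ∘ L⊆ys) (proj₁ ∘ L-above)
        (λ y≤x x∈A → ∈⇒∈↑ (∈L (y≤x , λ y≈x → y∉D++ys (∈↑-up (≤-reflexive (Eq.sym y≈x)) x∈A))))
        acyclic L-acyclic)

    -- Induction on n, starting in dimension -1: the empty upset has 1! = 1 maximal chain, the empty
    -- one, while in a nonempty upset the empty simplex is a boundary.
    manyChainsOrAcyclic : ∀ n X → Sorted X → Closed X → Outcome X n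
    manyChainsOrAcyclic zero    []      _ _ = inj₁ ((λ _ → empty) , λ { {zero} {zero} _ _ → refl })
      where
      empty : LongChain [] 0
      empty = record
        { chain     = mkChain [] []
        ; contained = []
        ; maximal   = λ { (mkChain [] _) _ _ () ; (mkChain (_ ∷ _) _) (() ∷ _) }
        ; long      = z≤n
        }
    manyChainsOrAcyclic zero    (x ∷ X) _ _ = inj₂ (nonempty-acyclic x X)
    manyChainsOrAcyclic (suc n) X sorted closed =
      sweep (manyChainsOrAcyclic n) [] X (λ ()) [] (All.universal (λ _ → []) X) sorted closed

    manyMaximalChains : ∀ {X} → Sorted X → (∀ x → x ∈ X) → ∀ k → ¬ IsTrivial (H̃ k) →
      Σ (Fin (suc (suc k) !) → MaximalChain) λ chains →
        (∀ {i j} → chains i ≋ chains j → i ≡ j) × (∀ i → HasLength≥ k (chains i))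
    manyMaximalChains {X} sorted complete k nontrivial =
      conclude (manyChainsOrAcyclic (suc k) X sorted (λ {x} _ → complete x))
      where
      everywhere : ∀ {n} (s : Vec C n) → In X s
      everywhere = Allᵛ.universal (λ x → ∈⇒∈↑ (complete x))

      maximalChain : LongChain X (suc k) → MaximalChain
      maximalChain s = record
        { chain   = chain s
        ; maximal = λ t → maximal s t (everywhere (elements t))
        }

      -- By `eval-∼[]`, vanishing coefficients of `∂ z` give the cycle condition. Conversely,
      -- indicator cochains turn the filling into an equality of coefficients.
      trivial : Acyclic X (suc k) → IsTrivial (H̃ k)
      trivial acyclic (z , ∂z∼[]) =
        let b , _ , z∼∂b = acyclic z (All.universal (λ (_ , s) → everywhere (elements s)) z)
                             λ g g-resp → trans (sym (eval-∂ z g)) (eval-∼[] (∂ z) ∂z∼[] g-resp)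
        in  b , λ s → trans (coeff-eval z s)
                  (trans (z∼∂b _ (indicator-resp (elements s)))
                    (trans (sym (eval-∂ b _)) (sym (coeff-eval (∂ b) s))))

      conclude : Outcome X (suc k) → Σ (Fin (suc (suc k) !) → MaximalChain) λ chains →
        (∀ {i j} → chains i ≋ chains j → i ≡ j) × (∀ i → HasLength≥ k (chains i))
      conclude (inj₁ (f , f-injective)) = maximalChain ∘ f , uncurry f-injective , long ∘ f
      conclude (inj₂ acyclic)           = contradiction (trivial acyclic) nontrivial

-- Intersections and enumeration of finite subsets.

∈-⋂⁺ : ∀ {n y} {ps : List (Subset n)} → All (y ∈ˢ_) ps → y ∈ˢ ⋂ ps
∈-⋂⁺ []       = ∈⊤
∈-⋂⁺ (i ∷ is) = x∈p∩q⁺ (i , ∈-⋂⁺ is)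

∈-⋂⁻ : ∀ {n y} (ps : List (Subset n)) → y ∈ˢ ⋂ ps → All (y ∈ˢ_) ps
∈-⋂⁻ []       _ = []
∈-⋂⁻ (p ∷ ps) i = let i , is = x∈p∩q⁻ p (⋂ ps) i in i ∷ ∈-⋂⁻ ps is

∈-tabulate⁺ : ∀ {n p} {Q : Fin n → Set p} (Q? : ∀ x → Dec (Q x)) {x} → Q x →
              x ∈ˢ Vec.tabulate (does ∘ Q?)
∈-tabulate⁺ Q? {x} q =
  Vec.lookup⇒[]= x _ (trans (Vec.lookup∘tabulate (does ∘ Q?) x) (dec-true (Q? x) q))

∈-tabulate⁻ : ∀ {n p} {Q : Fin n → Set p} (Q? : ∀ x → Dec (Q x)) {x} →
              x ∈ˢ Vec.tabulate (does ∘ Q?) → Q x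
∈-tabulate⁻ Q? {x} i with Q? x | trans (sym (Vec.lookup∘tabulate (does ∘ Q?) x)) (Vec.[]=⇒lookup i)
... | yes q | _  = q
... | no  _ | ()

-- Subsets in lexicographic order, which extends inclusion.
subsets : ∀ n → List (Subset n)
subsets zero    = [] ∷ []
subsets (suc n) = map (outside ∷_) (subsets n) ++ map (inside ∷_) (subsets n)

∈-subsets : ∀ {n} (p : Subset n) → p ∈ᴸ subsets n
∈-subsets []            = here refl
∈-subsets (outside ∷ p) = ∈ᴸ.∈-++⁺ˡ (∈ᴸ.∈-map⁺ (outside ∷_) (∈-subsets p))
∈-subsets (inside  ∷ p) = ∈ᴸ.∈-++⁺ʳ _ (∈ᴸ.∈-map⁺ (inside ∷_) (∈-subsets p))

-- Where two subsets first differ, the earlier has `outside` and the later `inside`, so the later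
-- has an element that the earlier lacks.
subsets-sorted : ∀ n → ListAllPairs (λ p q → ¬ q ⊆ p) (subsets n)
subsets-sorted zero    = [] ∷ []
subsets-sorted (suc n) = ListAllPairs.++⁺ (extended outside) (extended inside)
  (All.map⁺ (All.universal (λ p → All.map⁺ (All.universal (inside⊈outside {p}) _)) _))
  where
  ∷-⊈ : ∀ s {p q : Subset n} → ¬ q ⊆ p → ¬ (s ∷ q) ⊆ (s ∷ p)
  ∷-⊈ s q⊈p s∷q⊆s∷p = q⊈p (drop-∷-⊆ s∷q⊆s∷p)
  extended : ∀ s → ListAllPairs (λ p q → ¬ q ⊆ p) (map (s ∷_) (subsets n))
  extended s = ListAllPairs.map⁺ (ListAllPairs.map (λ {p} {q} → ∷-⊈ s {p} {q}) (subsets-sorted n))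
  inside⊈outside : ∀ {p : Subset n} q → ¬ (inside ∷ q) ⊆ (outside ∷ p)
  inside⊈outside q i⊆o with () ← i⊆o Vec.here

-- The doubly-labeled poset of a relation.

module RelationPoset {ℓ : Level} {m n : ℕ} (R : REL (Fin m) (Fin n) ℓ) (R? : Decidable R) where

  open Relation R R?
  open Homology P using (HasBoundedJoins)
  open MaximalChains P using (Sorted)

  ∈-⋂-members⁺ : ∀ {k l} (f : Fin k → Subset l) {p y} →
                 (∀ {x} → x ∈ˢ p → y ∈ˢ f x) → y ∈ˢ ⋂ (map f (members p))
  ∈-⋂-members⁺ f {p} y∈f = ∈-⋂⁺ (All.map⁺ (All.tabulate λ i →
    y∈f (proj₂ (∈ᴸ.∈-filter⁻ (_∈? p) {xs = List.allFin _} i))))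

  ∈-⋂-members⁻ : ∀ {k l} (f : Fin k → Subset l) {p x y} →
                 y ∈ˢ ⋂ (map f (members p)) → x ∈ˢ p → y ∈ˢ f x
  ∈-⋂-members⁻ f {p} i x∈p =
    All.lookup (All.map⁻ (∈-⋂⁻ (map f (members p)) i)) (∈ᴸ.∈-filter⁺ (_∈? p) (∈ᴸ.∈-allFin _) x∈p)

  ∈-φ⁺ : ∀ {s y} → (∀ {x} → x ∈ˢ s → R x y) → y ∈ˢ φ s
  ∈-φ⁺ r = ∈-⋂-members⁺ row λ {x} i → ∈-tabulate⁺ (R? x) (r i)

  ∈-φ⁻ : ∀ {s x y} → y ∈ˢ φ s → x ∈ˢ s → R x y
  ∈-φ⁻ {x = x} j i = ∈-tabulate⁻ (R? x) (∈-⋂-members⁻ row j i)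

  ∈-ψ⁺ : ∀ {t x} → (∀ {y} → y ∈ˢ t → R x y) → x ∈ˢ ψ t
  ∈-ψ⁺ r = ∈-⋂-members⁺ column λ {y} j → ∈-tabulate⁺ (λ x → R? x y) (r j)

  ∈-ψ⁻ : ∀ {t x y} → x ∈ˢ ψ t → y ∈ˢ t → R x y
  ∈-ψ⁻ {y = y} i j = ∈-tabulate⁻ (λ x → R? x y) (∈-⋂-members⁻ column i j)

  related : ∀ p {x y} → x ∈ˢ σ p → y ∈ˢ γ p → R x y
  related p x∈σ y∈γ = ∈-φ⁻ (subst (_ ∈ˢ_) (γ≡φσ p) y∈γ) x∈σ

  ∈-γ⁺ : ∀ p {y} → (∀ {x} → x ∈ˢ σ p → R x y) → y ∈ˢ γ p
  ∈-γ⁺ p r = subst (_ ∈ˢ_) (sym (γ≡φσ p)) (∈-φ⁺ r)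

  ∈-σ⁺ : ∀ p {x} → (∀ {y} → y ∈ˢ γ p → R x y) → x ∈ˢ σ p
  ∈-σ⁺ p r = subst (_ ∈ˢ_) (sym (σ≡ψγ p)) (∈-ψ⁺ r)

  γ-antitone : ∀ p q → p ≤ₚ q → γ q ⊆ γ p
  γ-antitone p q p≤q y∈γq = ∈-γ⁺ p λ x∈σp → related q (p≤q x∈σp) y∈γq

  -- An upper bound `z` has its nonempty `γ z` inside `γ p ∩ γ q`, so there is none if this
  -- intersection is empty. Otherwise the intersection is the second label of the join.
  boundedJoins : HasBoundedJoins
  boundedJoins p q with nonempty? (γ p ∩ γ q)
  ... | no  empty    = inj₂ λ {z} p≤z q≤z → let y , y∈γz = γ-nonempty z in
    empty (y , x∈p∩q⁺ (γ-antitone p z p≤z y∈γz , γ-antitone q z q≤z y∈γz))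
  ... | yes nonempty = inj₁ (join , σp⊆ , σq⊆ , λ {z} → least z)
    where
    t = γ p ∩ γ q
    σp⊆ : σ p ⊆ ψ t
    σp⊆ x∈σp = ∈-ψ⁺ λ y∈t → related p x∈σp (proj₁ (x∈p∩q⁻ (γ p) (γ q) y∈t))
    σq⊆ : σ q ⊆ ψ t
    σq⊆ x∈σq = ∈-ψ⁺ λ y∈t → related q x∈σq (proj₂ (x∈p∩q⁻ (γ p) (γ q) y∈t))
    join : Element
    join = record
      { σ          = ψ t
      ; γ          = t
      ; σ-nonempty = let x , x∈σp = σ-nonempty p in x , σp⊆ x∈σp
      ; γ-nonempty = nonempty
      ; σ≡ψγ       = refl
      -- A point of `φ (ψ t)` is related to all of `ψ t`, hence to all of `σ p` and `σ q`, and so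
      -- lies in `γ p` and `γ q`.
      ; γ≡φσ       = ⊆-antisym (λ y∈t → ∈-φ⁺ λ x∈ψt → ∈-ψ⁻ x∈ψt y∈t)
          (λ y∈φψt → x∈p∩q⁺ ( ∈-γ⁺ p (λ x∈σp → ∈-φ⁻ y∈φψt (σp⊆ x∈σp))
                              , ∈-γ⁺ q (λ x∈σq → ∈-φ⁻ y∈φψt (σq⊆ x∈σq))))
      }
    least : ∀ z → p ≤ₚ z → q ≤ₚ z → join ≤ₚ z
    least z p≤z q≤z x∈ψt = ∈-σ⁺ z λ y∈γz →
      ∈-ψ⁻ x∈ψt (x∈p∩q⁺ (γ-antitone p z p≤z y∈γz , γ-antitone q z q≤z y∈γz))

  -- The first label determines the second as its image under `φ`, so the search for an element
  -- reduces to three decidable conditions on `s`.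
  element? : ∀ s → Dec (∃ λ p → σ p ≡ s)
  element? s = map′
    (λ (s-nonempty , φs-nonempty , s≡ψφs) →
      record
        { σ-nonempty = s-nonempty
        ; γ-nonempty = φs-nonempty
        ; σ≡ψγ       = s≡ψφs
        ; γ≡φσ       = refl
        } , refl)
    (λ { (p , refl) → σ-nonempty p
                    , subst Nonempty (γ≡φσ p) (γ-nonempty p)
                    , trans (σ≡ψγ p) (cong ψ (γ≡φσ p)) })
    (nonempty? s ×-dec nonempty? (φ s) ×-dec Vec.≡-dec Bool._≟_ s (ψ (φ s)))

  elementsOver : List (Subset m) → List Element
  elementsOver []       = []
  elementsOver (s ∷ ss) with element? s
  ... | yes (p , _) = p ∷ elementsOver ss
  ... | no  _       = elementsOver ss

  All-elementsOver : ∀ {a} {Q : Subset m → Set a} {ss} → All Q ss → All (Q ∘ σ) (elementsOver ss)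
  All-elementsOver []                         = []
  All-elementsOver {ss = s ∷ _} (q ∷ qs) with element? s
  ... | yes (p , refl) = q ∷ All-elementsOver qs
  ... | no  _          = All-elementsOver qs

  elementsOver-sorted : ∀ {ss} → ListAllPairs (λ s t → ¬ t ⊆ s) ss → Sorted (elementsOver ss)
  elementsOver-sorted []                             = []
  elementsOver-sorted {s ∷ _} (s≱ss ∷ sorted) with element? s
  ... | yes (p , refl) = All-elementsOver s≱ss ∷ elementsOver-sorted sorted
  ... | no  _          = elementsOver-sorted sorted

  ∈-elementsOver : ∀ p {ss} → σ p ∈ᴸ ss → Any (p ≈ₚ_) (elementsOver ss)
  ∈-elementsOver p {s ∷ _} (here refl) with element? s
  ... | yes (q , σq≡s) = here (sym σq≡s , trans (γ≡φσ p) (trans (cong φ (sym σq≡s)) (sym (γ≡φσ q))))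
  ... | no  ¬p         = contradiction (p , refl) ¬p
  ∈-elementsOver p {s ∷ _} (there i) with element? s
  ... | yes _ = there (∈-elementsOver p i)
  ... | no  _ = ∈-elementsOver p i

open import Data.Nat.Base using (_+_)

corollary27 : ∀ {ℓ} {m n : ℕ} .{{_ : NonZero m}} .{{_ : NonZero n}}
    (R : REL (Fin m) (Fin n) ℓ) (R? : Decidable R) →
    let open OrderComplex (Relation.P R R?) in
    (k : ℕ) → ¬ IsTrivial (H̃ k) →
    Σ (Fin ((k + 2) !) → MaximalChain) λ chains →
    Injective _≡_ _≋_ chains × (∀ i → HasLength≥ k (chains i))
corollary27 {m = m} R R? k nontrivial rewrite ℕ.+-comm k 2 =
  -- Lexicographic order of the first labels is a linear extension of the poset. After the
  -- rewriting, the factorial of `2 + k` is the number of chains supplied.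
  manyMaximalChains boundedJoins (elementsOver-sorted (subsets-sorted m))
    (λ p → ∈-elementsOver p (∈-subsets (Relation.σ p))) k nontrivial
  where
  open RelationPoset R R?
  open MaximalChains (Relation.P R R?)
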